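{- There is a polynomial-time algorithm deciding whether a given pseudo-chordal graph $G$ has a perfect matching cut.
   Context: Graphs are finite, simple and undirected. A cut of a graph $G=(V,E)$ is a partition $V=X\cup Y$ of the vertex set into disjoint non-empty sets $X,Y$; its edge cut $E(X,Y)$ is the set of all edges with one endvertex in $X$ and the other in $Y$. A perfect matching cut of $G$ is an edge cut $E(X,Y)$ that is a perfect matching of $G$; equivalently, every vertex of $X$ has exactly one neighbor in $Y$ and every vertex of $Y$ has exactly one neighbor in $X$. The maximal 2-connected subgraphs of a graph are called its blocks, and a block is non-trivial if it contains at least $3$ vertices. A graph is pseudo-chordal if, for every non-trivial block $B$, every edge of $B$ belongs to a triangle. -}

module Defs where

open import Data.Bool.Base using (Bool; true; false; T)
open import Data.Fin.Base using (Fin; zero)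
open import Data.Fin.Subset using (Subset; _∈_; _⊆_; _∩_; _∪_; _-_; ⊤; ∣_∣; Nonempty; Empty)
open import Data.List.Base using (List; []; _∷_; tabulate)
open import Data.Nat.Base using (ℕ; suc; _+_; _*_; _^_; _≤_)
open import Data.Product using (Σ; ∃; ∃!; _×_; _,_)
open import Data.Sum.Base using (_⊎_)
open import Data.Vec.Base using (Vec; _∷_; head; lookup; replicate; _[_]≔_)
open import Relation.Binary.Construct.Closure.ReflexiveTransitive using (Star)
open import Relation.Binary.PropositionalEquality using (_≡_)
open import Relation.Nullary using (Dec; does)

------------------------------------------------------------------------
-- Graphs

record Graph : Set where
  field
    order       : ℕ
    adj         : Fin order → Fin order → Bool
    symmetric   : ∀ u v → adj u v ≡ adj v u
    irreflexive : ∀ v → adj v v ≡ false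

  Vertex : Set
  Vertex = Fin order

  Adj : Vertex → Vertex → Set
  Adj u v = T (adj u v)

open Graph using (order; Vertex; Adj)

record Cut (G : Graph) : Set where
  field
    X Y      : Subset (order G)
    disjoint : Empty (X ∩ Y)
    covering : X ∪ Y ≡ ⊤
    X≢∅      : Nonempty X
    Y≢∅      : Nonempty Y

-- Edge sets are given as relations on vertices.
EdgeCut : ∀ {G} → Cut G → Vertex G → Vertex G → Set
EdgeCut {G} C u v = Adj G u v × ((u ∈ X × v ∈ Y) ⊎ (u ∈ Y × v ∈ X))
  where open Cut C

record IsPerfectMatching (G : Graph) (M : Vertex G → Vertex G → Set) : Set where
  field
    edges     : ∀ {u v} → M u v → Adj G u v
    symmetric : ∀ {u v} → M u v → M v u
    perfect   : ∀ v → ∃! _≡_ (M v)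

HasPerfectMatchingCut : Graph → Set
HasPerfectMatchingCut G = Σ (Cut G) λ C → IsPerfectMatching G (EdgeCut C)

record Subgraph (G : Graph) : Set where
  field
    vertices  : Subset (order G)
    edge      : Vertex G → Vertex G → Bool
    symmetric : ∀ u v → edge u v ≡ edge v u
    endpoint  : ∀ {u v} → T (edge u v) → u ∈ vertices
    edge⇒adj  : ∀ {u v} → T (edge u v) → Adj G u v

  Edge : Vertex G → Vertex G → Set
  Edge u v = T (edge u v)

  -- Any two vertices of W are joined by a walk of the subgraph inside W.
  ConnectedOn : Subset (order G) → Set
  ConnectedOn W = ∀ {u v} → u ∈ W → v ∈ W →
    Star (λ a b → Edge a b × a ∈ W × b ∈ W) u v

open Subgraph using (vertices; Edge; ConnectedOn)

record _⊑_ {G : Graph} (H K : Subgraph G) : Set where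
  field
    vertices-⊆ : vertices H ⊆ vertices K
    edges-⊆    : ∀ {u v} → Edge H u v → Edge K u v

-- With the convention usual for blocks, K₁ and K₂ count as 2-connected;
-- non-triviality of a block excludes both.
record TwoConnected {G : Graph} (H : Subgraph G) : Set where
  field
    nonempty    : Nonempty (vertices H)
    connected   : ConnectedOn H (vertices H)
    noCutvertex : ∀ {v} → v ∈ vertices H → ConnectedOn H (vertices H - v)

record IsBlock {G : Graph} (B : Subgraph G) : Set where
  field
    twoConnected : TwoConnected B
    maximal      : ∀ K → TwoConnected K → B ⊑ K → K ⊑ B

NonTrivial : ∀ {G} → Subgraph G → Set
NonTrivial B = 3 ≤ ∣ vertices B ∣

InTriangle : (G : Graph) → Vertex G → Vertex G → Set
InTriangle G u v = ∃ λ w → Adj G u v × Adj G v w × Adj G w u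

PseudoChordal : Graph → Set
PseudoChordal G = (B : Subgraph G) → IsBlock B → NonTrivial B →
  ∀ {u v} → Edge B u v → InTriangle G u v

------------------------------------------------------------------------
-- Algorithms
--
-- The model of computation is a variant of the language WHILE of
-- N. D. Jones, "Computability and Complexity: From a Programming
-- Perspective" (1997), with a skip command and a conditional added and
-- without the equality test on atoms, nil being the only atom.  Values are
-- binary trees, and each basic operation takes unit time (trees being
-- shared pointer structures, nothing is copied).  As for WHILE, the problems
-- decidable in polynomial time in this model are those decidable in
-- polynomial time by Turing machines.

infixr 5 _∙_

data Tree : Set where
  nil : Tree
  _∙_ : Tree → Tree → Tree

size : Tree → ℕ
size nil     = 1
size (a ∙ b) = 1 + size a + size b

hdᵗ tlᵗ : Tree → Tree
hdᵗ nil     = nil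
hdᵗ (a ∙ b) = a
tlᵗ nil     = nil
tlᵗ (a ∙ b) = b

-- Expressions and commands over k variables.
data Expr (k : ℕ) : Set where
  var   : Fin k → Expr k
  nil   : Expr k
  cons  : Expr k → Expr k → Expr k
  hd tl : Expr k → Expr k

infix  6 _≔_
infixr 5 _⨾_

data Cmd (k : ℕ) : Set where
  skip          : Cmd k
  _≔_           : Fin k → Expr k → Cmd k
  _⨾_           : Cmd k → Cmd k → Cmd k
  if_then_else_ : Expr k → Cmd k → Cmd k → Cmd k
  while_loop_   : Expr k → Cmd k → Cmd k

Store : ℕ → Set
Store k = Vec Tree k

eval : ∀ {k} → Expr k → Store k → Tree
eval (var x)    s = lookup s x
eval nil        s = nil
eval (cons e f) s = eval e s ∙ eval f s
eval (hd e)     s = hdᵗ (eval e s)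
eval (tl e)     s = tlᵗ (eval e s)

cost : ∀ {k} → Expr k → ℕ
cost (var x)    = 1
cost nil        = 1
cost (cons e f) = 1 + cost e + cost f
cost (hd e)     = 1 + cost e
cost (tl e)     = 1 + cost e

-- ⟨ c , s ⟩⇓[ t ] s′ : run from store s, the command c halts in store s′
-- after t time units.  In tests, nil is false and everything else is true.
infix 4 ⟨_,_⟩⇓[_]_

data ⟨_,_⟩⇓[_]_ {k : ℕ} : Cmd k → Store k → ℕ → Store k → Set where

  ⇓-skip : ∀ {s} →
    ⟨ skip , s ⟩⇓[ 1 ] s

  ⇓-assign : ∀ {x e s} →
    ⟨ x ≔ e , s ⟩⇓[ 1 + cost e ] (s [ x ]≔ eval e s)

  ⇓-seq : ∀ {c d s s′ s″ t t′} →
    ⟨ c , s ⟩⇓[ t ] s′ →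
    ⟨ d , s′ ⟩⇓[ t′ ] s″ →
    ⟨ c ⨾ d , s ⟩⇓[ 1 + t + t′ ] s″

  ⇓-if-true : ∀ {e c d s s′ t a b} →
    eval e s ≡ a ∙ b →
    ⟨ c , s ⟩⇓[ t ] s′ →
    ⟨ if e then c else d , s ⟩⇓[ 1 + cost e + t ] s′

  ⇓-if-false : ∀ {e c d s s′ t} →
    eval e s ≡ nil →
    ⟨ d , s ⟩⇓[ t ] s′ →
    ⟨ if e then c else d , s ⟩⇓[ 1 + cost e + t ] s′

  ⇓-while-true : ∀ {e c s s′ s″ t t′ a b} →
    eval e s ≡ a ∙ b →
    ⟨ c , s ⟩⇓[ t ] s′ →
    ⟨ while e loop c , s′ ⟩⇓[ t′ ] s″ →
    ⟨ while e loop c , s ⟩⇓[ 1 + cost e + t + t′ ] s″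

  ⇓-while-false : ∀ {e c s} →
    eval e s ≡ nil →
    ⟨ while e loop c , s ⟩⇓[ 1 + cost e ] s

-- Variable zero holds the input on start and the output on halting; all
-- other variables start as nil.
record Program : Set where
  field
    auxiliary : ℕ
    body      : Cmd (suc auxiliary)

Run : Program → (input : Tree) (time : ℕ) (output : Tree) → Set
Run p i t o = ∃ λ s →
  ⟨ body , i ∷ replicate auxiliary nil ⟩⇓[ t ] s × head s ≡ o
  where open Program p

------------------------------------------------------------------------
-- Encodings

encodeBool : Bool → Tree
encodeBool false = nil
encodeBool true  = nil ∙ nil

encodeList : {A : Set} → (A → Tree) → List A → Tree
encodeList enc []       = nil
encodeList enc (x ∷ xs) = enc x ∙ encodeList enc xs

-- A graph is input as its adjacency matrix, a list of rows of bits.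
encodeGraph : Graph → Tree
encodeGraph G =
  encodeList (encodeList encodeBool) (tabulate λ u → tabulate λ v → adj u v)
  where open Graph G

------------------------------------------------------------------------
-- Polynomial-time decidability

-- A single program answers "P a ?" for every instance a satisfying Promise,
-- in time polynomial in the size of the encoded instance.  Nothing is
-- required of its behaviour on other inputs.
PolyTimeDecidable : {A : Set} (encode : A → Tree) (Promise P : A → Set) → Set
PolyTimeDecidable {A} encode Promise P =
  Σ Program λ p → ∃ λ c → ∃ λ d →
    (a : A) → Promise a →
      ∃ λ t → t ≤ c * size (encode a) ^ d + c ×
        Σ (Dec (P a)) λ P? → Run p (encode a) t (encodeBool (does P?))

{-# OPTIONS --safe #-}
module Submission where

-- An edge of a triangle is never in a perfect matching cut.  In a pseudo-chordal
-- graph the other edges, called ties below, are all bridges, so they form a forest;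
-- conversely, any perfect matching consisting of bridges is an edge cut, as flipping
-- the colours on one side of each of its edges in turn yields a 2-colouring in which
-- exactly the edges of the matching are bichromatic.  Hence a non-empty graph has a
-- perfect matching cut iff its ties contain a perfect matching, and in a forest that
-- is decided greedily, by repeatedly matching a leaf with its only neighbour.
--
-- The algorithm is written in a first-order functional language whose loops all run
-- exactly n times, n being the number of vertices, so that the running time of every
-- program of the language is at most a polynomial in n; the language is compiled to
-- commands.

open import Defs

open import Data.Bool.Base using (Bool; true; false; T; _∧_; _xor_)
import Data.Bool.Properties as Bool
open import Data.Empty using (⊥; ⊥-elim)
open import Data.Fin.Base using (Fin; zero; suc; toℕ; fromℕ<)
import Data.Fin.Properties as Fin
open import Data.Fin.Subset
  using (Subset; _∈_; _∉_; _⊆_; _⊂_; _∩_; _-_; ∁; ∣_∣; Nonempty; ⁅_⁆)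
open import Data.Fin.Subset.Properties
open import Data.List.Base using (List; []; _∷_; [_])
import Data.List.Base as L
import Data.List.Membership.DecPropositional as DecMembership
import Data.List.Membership.Propositional as ListMembership
open import Data.List.Relation.Unary.Any using (here; there)
open import Data.Nat.Base
  using (ℕ; zero; suc; _+_; _*_; _∸_; _^_; _⊔_; _≤_; _<_; s≤s; z≤n)
import Data.Nat.Properties as ℕ
open import Data.Product using (Σ; ∃; ∃!; _×_; _,_; proj₁; proj₂)
open import Data.Sum.Base using (_⊎_; inj₁; inj₂)
open import Data.Unit.Base using (⊤; tt)
open import Data.Vec.Base using (Vec; []; _∷_; lookup; replicate; tabulate; _[_]≔_)
open import Data.Vec.Properties
  using ([]=⇒lookup; lookup⇒[]=; lookup∘tabulate; lookup∘update; lookup∘update′; lookup-replicate)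
open import Effect.Monad using (RawMonad)
open import Function.Base using (_∘_; id)
open import Function.Bundles using (Equivalence)
open import Level using (0ℓ)
open import Relation.Binary.Construct.Closure.ReflexiveTransitive
  using (Star; ε; _◅_; _◅◅_; gmap; reverse)
open import Relation.Binary.Core using (Rel)
open import Relation.Binary.PropositionalEquality
  using (_≡_; _≢_; refl; sym; trans; cong; cong₂; subst; module ≡-Reasoning)
open import Relation.Nullary
  using (¬_; Dec; yes; no; does; contradiction; ¬?; _×-dec_; _→-dec_; T?; Reflects; ofʸ; ofⁿ; _because_)
open import Relation.Nullary.Decidable using (decidable-stable; dec-true; ¬¬-excluded-middle)
open import Relation.Nullary.Negation using (¬¬-Monad)
open import Relation.Nullary.Reflects using (T-reflects)
open import Relation.Unary using (Pred; Decidable)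

-- Finite subsets and simple paths.

select : ∀ {n} {P : Pred (Fin n) 0ℓ} → Decidable P → Subset n
select P? = tabulate (does ∘ P?)

module _ {n} {P : Pred (Fin n) 0ℓ} (P? : Decidable P) where

  ∈-select⁺ : ∀ {x} → P x → x ∈ select P?
  ∈-select⁺ {x} px = lookup⇒[]= x _ (trans (lookup∘tabulate _ x) (dec-true (P? x) px))

  ∈-select⁻ : ∀ {x} → x ∈ select P? → P x
  ∈-select⁻ {x} x∈ with P? x | trans (sym (lookup∘tabulate (does ∘ P?) x)) ([]=⇒lookup x∈)
  ... | yes px | _ = px

-- Removing a member strictly lowers the cardinality, but removing `x` a second time changes
-- nothing.
x∉p-x : ∀ {n} {p : Subset n} {x} → x ∉ p - x
x∉p-x {p = p} {x} x∈ = ℕ.<-irrefl (cong ∣_∣ (p─q─q≡p─q p ⁅ x ⁆)) (x∈p⇒∣p-x∣<∣p∣ x∈)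

3≤∣p∣ : ∀ {n} {p : Subset n} {x y z} → x ∈ p → y ∈ p → z ∈ p → y ≢ x → z ≢ x → z ≢ y → 3 ≤ ∣ p ∣
3≤∣p∣ x∈ y∈ z∈ y≢x z≢x z≢y =
  ℕ.≤-<-trans (ℕ.≤-<-trans (ℕ.≤-<-trans z≤n (x∈p⇒∣p-x∣<∣p∣ z∈″)) (x∈p⇒∣p-x∣<∣p∣ y∈′)) (x∈p⇒∣p-x∣<∣p∣ x∈)
  where
  y∈′ = x∈p∧x≢y⇒x∈p-y y∈ y≢x
  z∈″ = x∈p∧x≢y⇒x∈p-y (x∈p∧x≢y⇒x∈p-y z∈ z≢x) z≢y

module _ {n} (_⇢_ : Rel (Fin n) 0ℓ) (end : Fin n) where

  open ListMembership using () renaming (_∈_ to _∈ˡ_; _∉_ to _∉ˡ_)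
  open DecMembership (Fin._≟_ {n}) using () renaming (_∈?_ to _∈ˡ?_)

  data SimplePath : Fin n → List (Fin n) → Set where
    stop : SimplePath end [ end ]
    step : ∀ {a b vs} → a ⇢ b → SimplePath b vs → a ∉ˡ vs → SimplePath a (a ∷ vs)

  start∈ : ∀ {a vs} → SimplePath a vs → a ∈ˡ vs
  start∈ stop         = here refl
  start∈ (step _ _ _) = here refl

  end∈ : ∀ {a vs} → SimplePath a vs → end ∈ˡ vs
  end∈ stop         = here refl
  end∈ (step _ p _) = there (end∈ p)

  suffix : ∀ {a b vs} → SimplePath b vs → a ∈ˡ vs → ∃ (SimplePath a)
  suffix stop           (here refl) = _ , stop
  suffix p@(step _ _ _) (here refl) = _ , p
  suffix (step _ p _)   (there a∈)  = suffix p a∈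

  simplify : ∀ {a} → Star _⇢_ a end → ∃ (SimplePath a)
  simplify ε = _ , stop
  simplify {a} (e ◅ es) with simplify es
  ... | vs , p with a ∈ˡ? vs
  ...   | yes a∈ = suffix p a∈
  ...   | no  a∉ = _ , step e p a∉

  module _ (P : Pred (Fin n) 0ℓ) where

    Joined : Rel (Fin n) 0ℓ
    Joined = Star λ a b → a ⇢ b × P a × P b

    joined-end : ∀ {a y vs} → SimplePath a vs → (∀ {x} → x ∈ˡ vs → P x) → y ∈ˡ vs → Joined y end
    joined-end stop         f (here refl) = ε
    joined-end (step e p _) f (here refl) =
      (e , f (here refl) , f (there (start∈ p))) ◅ joined-end p (f ∘ there) (start∈ p)
    joined-end (step e p _) f (there y∈)  = joined-end p (f ∘ there) y∈

    -- On a simple path, z cannot lie both before and after y.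
    joined-avoiding : ∀ {a y z vs} → SimplePath a vs → (∀ {x} → x ∈ˡ vs → x ≢ z → P x) →
                      y ∈ˡ vs → y ≢ z → (P a × Joined a y) ⊎ (P end × Joined y end)
    joined-avoiding stop         f (here refl) y≢z = inj₁ (f (here refl) y≢z , ε)
    joined-avoiding (step e p _) f (here refl) y≢z = inj₁ (f (here refl) y≢z , ε)
    joined-avoiding {a} {z = z} (step e p a∉) f (there y∈) y≢z with a Fin.≟ z
    ... | yes refl = inj₂ (f′ (end∈ p) , joined-end p f′ y∈)
      where
      f′ : ∀ {x} → x ∈ˡ _ → P x
      f′ x∈ = f (there x∈) λ { refl → a∉ x∈ }
    ... | no a≢z with joined-avoiding p (f ∘ there) y∈ y≢z
    ...   | inj₁ (Pb , j) = inj₁ (f (here refl) a≢z , (e , f (here refl) a≢z , Pb) ◅ j)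
    ...   | inj₂ r        = inj₂ r

-- Ties, bridges and blocks of a graph.

module GraphTheory (G : Graph) where

  open Graph G

  adj-sym : ∀ {u v} → Adj u v → Adj v u
  adj-sym {u} {v} = subst T (symmetric u v)

  adj-irrefl : ∀ {v} → ¬ Adj v v
  adj-irrefl {v} = subst T (irreflexive v)

  Tie : Vertex → Vertex → Set
  Tie u v = Adj u v × ¬ ∃ λ w → Adj u w × Adj v w

  tie-sym : ∀ {u v} → Tie u v → Tie v u
  tie-sym (a , ¬t) = adj-sym a , λ (w , b , c) → ¬t (w , c , b)

  tie⇒¬triangle : ∀ {u v} → Tie u v → ¬ InTriangle G u v
  tie⇒¬triangle (_ , ¬t) (w , _ , b , c) = ¬t (w , adj-sym c , b)

  -- Additional edges on the same vertices preserve 2-connectedness, so the search for a block can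
  -- be confined to induced subgraphs and measured by the number of vertices.
  Induced : Subset order → Subgraph G
  Induced W = record
    { vertices  = W
    ; edge      = λ u v → adj u v ∧ (lookup W u ∧ lookup W v)
    ; symmetric = λ u v → cong₂ _∧_ (symmetric u v) (Bool.∧-comm (lookup W u) _)
    ; endpoint  = λ {u} {v} e → lookup⇒[]= u W (Equivalence.to Bool.T-≡
                    (proj₁ (T-∧⁻ (lookup W u) (proj₂ (T-∧⁻ (adj u v) e)))))
    ; edge⇒adj  = λ {u} {v} → proj₁ ∘ T-∧⁻ (adj u v)
    }
    where
    T-∧⁻ : ∀ a {b} → T (a ∧ b) → T a × T b
    T-∧⁻ a = Equivalence.to (Bool.T-∧ {a})

  induced-edge : ∀ {W u v} → Adj u v → u ∈ W → v ∈ W → Subgraph.Edge (Induced W) u v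
  induced-edge {W} {u} {v} uv u∈ v∈ =
    Equivalence.from (Bool.T-∧ {adj u v}) (uv , Equivalence.from (Bool.T-∧ {lookup W u}) (T∈ u∈ , T∈ v∈))
    where
    T∈ : ∀ {W u} → u ∈ W → T (lookup W u)
    T∈ = Equivalence.from Bool.T-≡ ∘ []=⇒lookup

  module _ (v w : Vertex) where

    -- Deleting vw in the direction from v to w only is enough, as a simple path from v
    -- to w never uses it in the other direction.
    Bypass : Rel Vertex 0ℓ
    Bypass a b = Adj a b × ¬ (a ≡ v × b ≡ w)

    Separates : Subset order → Set
    Separates S = v ∈ S × w ∉ S × ∀ a b → Adj a b → a ∈ S → b ∉ S → a ≡ v × b ≡ w

    separates? : Decidable Separates
    separates? S = (v ∈? S) ×-dec ¬? (w ∈? S) ×-dec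
      Fin.all? λ a → Fin.all? λ b →
        T? (adj a b) →-dec (a ∈? S) →-dec ¬? (b ∈? S) →-dec ((a Fin.≟ v) ×-dec (b Fin.≟ w))

    -- Witnessed by one side of the separation rather than by unreachability: this makes the notion
    -- decidable by finite search, and the side is the set on which colours get flipped.
    Bridge : Set
    Bridge = ∃ Separates

    bridge? : Dec Bridge
    bridge? = anySubset? separates?

    -- The separating set is the set of vertices reachable from v without the edge vw.
    ¬bypass⇒bridge : ¬ Star Bypass v w → ¬ ¬ Bridge
    ¬bypass⇒bridge ¬vw ¬bridge =
      -- The goal is a negation, so reachability may be assumed decidable at each of the finitely
      -- many vertices.
      Fin.sequence (RawMonad.rawApplicative ¬¬-Monad) (λ x → ¬¬-excluded-middle) bridge
      where
      bridge : ¬ (∀ x → Dec (Star Bypass v x))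
      bridge reach? = ¬bridge (select reach? , ∈-select⁺ reach? ε , ¬vw ∘ ∈-select⁻ reach? , crossing)
        where
        crossing : ∀ a b → Adj a b → a ∈ select reach? → b ∉ select reach? → a ≡ v × b ≡ w
        crossing a b ab a∈ b∉ with (a Fin.≟ v) ×-dec (b Fin.≟ w)
        ... | yes eq = eq
        ... | no  ≢  = contradiction (∈-select⁺ reach? (∈-select⁻ reach? a∈ ◅◅ (ab , ≢) ◅ ε)) b∉

    module Cycle (vw : Adj v w) {vs} (path : SimplePath Bypass w v vs) where

      open ListMembership using () renaming (_∈_ to _∈ˡ_)
      open DecMembership (Fin._≟_ {order}) using () renaming (_∈?_ to _∈ˡ?_)

      cycle : Subset order
      cycle = select (_∈ˡ? vs)

      in-cycle : ∀ {x} → x ∈ˡ vs → x ∈ cycle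
      in-cycle = ∈-select⁺ (_∈ˡ? vs)

      from-cycle : ∀ {x} → x ∈ cycle → x ∈ˡ vs
      from-cycle = ∈-select⁻ (_∈ˡ? vs)

      3≤cycle : 3 ≤ ∣ cycle ∣
      3≤cycle = three path in-cycle
        where
        three : ∀ {us} → SimplePath Bypass w v us → (∀ {x} → x ∈ˡ us → x ∈ cycle) → 3 ≤ ∣ cycle ∣
        three stop _ = contradiction vw adj-irrefl
        -- The three vertices are `v`, its successor on the path and `w`; the successor is not `w`
        -- because the path avoids the edge `vw`.
        three p@(step (vb , ¬vw) q _) ∈cycle = 3≤∣p∣
          (∈cycle (start∈ _ _ p)) (∈cycle (there (start∈ _ _ q))) (∈cycle (end∈ _ _ p))
          (λ { refl → adj-irrefl vb }) (λ { refl → adj-irrefl vw }) (λ { refl → ¬vw (refl , refl) })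

      module _ {W : Subset order} (W⊆ : W ⊆ cycle) where

        Link : Rel Vertex 0ℓ
        Link a b = Subgraph.Edge (Induced cycle) a b × a ∈ W × b ∈ W

        link-sym : ∀ {a b} → Link a b → Link b a
        link-sym (e , a∈ , b∈) = subst T (Subgraph.symmetric (Induced cycle) _ _) e , b∈ , a∈

        link : ∀ {a b} → Adj a b → a ∈ W → b ∈ W → Link a b
        link ab a∈ b∈ = induced-edge ab (W⊆ a∈) (W⊆ b∈) , a∈ , b∈

        links : ∀ {a b} → Joined Bypass w (_∈ W) a b → Star Link a b
        links = gmap id λ ((ab , _) , a∈ , b∈) → link ab a∈ b∈

      -- Without `z`, every other vertex of the path is still joined along it to `v` or to `w`. Two
      -- vertices joined to different ends are connected through the edge `vw`, which closes the
      -- path to a cycle.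
      twoConnected : TwoConnected (Induced cycle)
      twoConnected = record
        { nonempty    = v , in-cycle (start∈ _ _ path)
        ; connected   = λ x∈ y∈ → to-w x∈ ◅◅ reverse (link-sym id) (to-w y∈)
        ; noCutvertex = λ {z} _ x∈ y∈ → around z x∈ y∈
        }
        where
        to-w : ∀ {x} → x ∈ cycle → Star (Link id) x w
        to-w x∈ = links id (joined-end _ _ _ path in-cycle (from-cycle x∈))
        around : ∀ z {x y} → x ∈ cycle - z → y ∈ cycle - z → Star (Link {cycle - z} (p─q⊆p _ _)) x y
        around z {x} {y} x∈ y∈ = join (side x∈) (side y∈)
          where
          W⊆ : cycle - z ⊆ cycle
          W⊆ = p─q⊆p _ _
          Side : Vertex → Set
          Side x = (v ∈ cycle - z × Star (Link W⊆) v x) ⊎ (w ∈ cycle - z × Star (Link W⊆) x w)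
          side : ∀ {x} → x ∈ cycle - z → Side x
          side {x} x∈ with joined-avoiding Bypass w (_∈ cycle - z) {z = z} path
                       (λ x∈ x≢z → x∈p∧x≢y⇒x∈p-y (in-cycle x∈) x≢z) (from-cycle (W⊆ x∈)) (λ { refl → x∉p-x x∈ })
          ... | inj₁ (v∈ , j) = inj₁ (v∈ , links W⊆ j)
          ... | inj₂ (w∈ , j) = inj₂ (w∈ , links W⊆ j)
          back : ∀ {x y} → Star (Link W⊆) x y → Star (Link W⊆) y x
          back = reverse (link-sym W⊆)
          join : ∀ {x y} → Side x → Side y → Star (Link W⊆) x y
          join (inj₁ (_  , j)) (inj₁ (_  , k)) = back j ◅◅ k
          join (inj₁ (v∈ , j)) (inj₂ (w∈ , k)) = back j ◅◅ link W⊆ vw v∈ w∈ ◅ back k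
          join (inj₂ (w∈ , j)) (inj₁ (v∈ , k)) = j ◅◅ link W⊆ (adj-sym vw) w∈ v∈ ◅ k
          join (inj₂ (_  , j)) (inj₂ (_  , k)) = j ◅◅ back k

  module _ (pseudoChordal : PseudoChordal G) where

    -- If the subgraph is not a block, the induction continues in a larger one; k bounds the
    -- number of vertices outside it.
    twoConnected⇒triangle : ∀ k {W v w} → order ∸ ∣ W ∣ ≤ k → TwoConnected (Induced W) → 3 ≤ ∣ W ∣ →
                            v ∈ W → w ∈ W → Adj v w → ¬ ¬ InTriangle G v w
    twoConnected⇒triangle k {W} {v} {w} ≤k W-2c 3≤ v∈ w∈ vw ¬tri =
      -- Maximality of `Induced W` is proved under the assumption `¬tri`: a 2-connected subgraph
      -- with more vertices would contain `vw` as well and, by induction, refute `¬tri`.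
      ¬tri (pseudoChordal (Induced W) block 3≤ (induced-edge vw v∈ w∈))
      where
      open _⊑_
      larger : ∀ k K → order ∸ ∣ W ∣ ≤ k → TwoConnected K → W ⊂ Subgraph.vertices K → ¬ ¬ InTriangle G v w
      larger zero K ≤0 _ W⊂K =
        contradiction (p⊂q⇒∣p∣<∣q∣ W⊂K) (ℕ.≤⇒≯ (ℕ.≤-trans (∣p∣≤n (Subgraph.vertices K)) (ℕ.m∸n≡0⇒m≤n (ℕ.n≤0⇒n≡0 ≤0))))
      larger (suc k) K ≤k K-2c W⊂K@(W⊆K , _) =
        twoConnected⇒triangle k
          (ℕ.≤-pred (ℕ.≤-trans (ℕ.∸-monoʳ-< W<V (∣p∣≤n V)) ≤k)) V-2c
          (ℕ.≤-trans 3≤ (ℕ.<⇒≤ W<V)) (W⊆K v∈) (W⊆K w∈) vw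
        where
        V = Subgraph.vertices K
        W<V = p⊂q⇒∣p∣<∣q∣ W⊂K
        widen : ∀ {U} → U ⊆ V → Subgraph.ConnectedOn K U → Subgraph.ConnectedOn (Induced V) U
        widen U⊆ c x∈ y∈ = gmap id (λ (e , a∈ , b∈) →
          induced-edge (Subgraph.edge⇒adj K e) (U⊆ a∈) (U⊆ b∈) , a∈ , b∈) (c x∈ y∈)
        V-2c : TwoConnected (Induced V)
        V-2c = record
          { nonempty    = TwoConnected.nonempty K-2c
          ; connected   = widen id (TwoConnected.connected K-2c)
          ; noCutvertex = λ z∈ → widen (p─q⊆p _ _) (TwoConnected.noCutvertex K-2c z∈)
          }
      block : IsBlock (Induced W)
      block = record { twoConnected = W-2c ; maximal = maximal }
        where
        maximal : ∀ K → TwoConnected K → Induced W ⊑ K → K ⊑ Induced W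
        maximal K K-2c W⊑K with Subgraph.vertices K ⊆? W
        ... | yes K⊆W = record
          { vertices-⊆ = K⊆W
          ; edges-⊆    = λ {a} {b} e → induced-edge (Subgraph.edge⇒adj K e) (K⊆W (Subgraph.endpoint K e))
              (K⊆W (Subgraph.endpoint K (subst T (Subgraph.symmetric K a b) e)))
          }
        ... | no K⊈W = contradiction (λ {x} → K⊆W {x}) K⊈W
          where
          K⊆W : Subgraph.vertices K ⊆ W
          K⊆W {x} x∈ = decidable-stable (x ∈? W) λ x∉ →
            larger k K ≤k K-2c (vertices-⊆ W⊑K , x , x∈ , x∉) ¬tri

    -- If a walk from `v` to `w` bypassed the edge, a simple one would close to a cycle through
    -- `vw`. The cycle is 2-connected with at least three vertices, which puts `vw` in a triangle.
    tie⇒bridge : ∀ {v w} → Tie v w → Bridge v w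
    tie⇒bridge {v} {w} tie@(vw , _) = decidable-stable (bridge? v w) (¬bypass⇒bridge v w ¬bypass)
      where
      ¬bypass : ¬ Star (Bypass v w) v w
      ¬bypass walk with simplify _ _ walk
      ... | _ , path = twoConnected⇒triangle _ ℕ.≤-refl twoConnected 3≤cycle
              (in-cycle (start∈ _ _ path)) (in-cycle (end∈ _ _ path)) vw (tie⇒¬triangle tie)
        where open Cycle v w vw path

-- Greedy matching: colourings, and comparison with a given cut.

∉⇒lookup : ∀ {n} {p : Subset n} {x} → x ∉ p → lookup p x ≡ false
∉⇒lookup {p = p} {x} x∉ = Bool.¬-not (x∉ ∘ lookup⇒[]= x p)

xor-cancelʳ : ∀ {a b k l} → k ≡ l → a xor k ≡ b xor l → a ≡ b
xor-cancelʳ {a} {b} {k} refl eq = trans (sym (invol a)) (trans (cong (_xor k) eq) (invol b))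
  where
  invol : ∀ a → (a xor k) xor k ≡ a
  invol a = trans (Bool.xor-assoc a k k) (trans (cong (a xor_) (Bool.xor-same k)) (Bool.xor-identityʳ a))

module Greedy (G : Graph) where

  open Graph G
  open GraphTheory G

  -- R is the set of vertices still to be matched.
  Leaf : Subset order → Vertex → Vertex → Set
  Leaf R v w = v ∈ R × w ∈ R × Tie v w × (∀ {x} → x ∈ R → Tie v x → x ≡ w)

  -- A greedy round as a relation, so that the invariants hold whichever leaf is picked and however
  -- the set is computed.
  record Prune (R R′ : Subset order) : Set where
    field
      {v w} : Vertex
      leaf  : Leaf R v w
      kept  : ∀ {x} → x ∈ R′ → x ∈ R × x ≢ v × x ≢ w
      keeps : ∀ {x} → x ∈ R → x ≢ v → x ≢ w → x ∈ R′

  Bichromatic : (Vertex → Bool) → Vertex → Vertex → Set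
  Bichromatic c x y = Adj x y × c x ≢ c y

  -- The bichromatic edges form a perfect matching of the complement of `R`. A constant colouring is
  -- balanced for the full set, and for the empty set the colour classes form a perfect matching
  -- cut.
  Balanced : Subset order → (Vertex → Bool) → Set
  Balanced R c = ∀ x → (x ∈ R → ∀ y → ¬ Bichromatic c x y) × (x ∉ R → ∃! _≡_ (Bichromatic c x))

  -- Flipping the colours on one side of the bridge vw changes the status of vw only.
  module _ {R R′ c} (tie⇒bridge : ∀ {v w} → Tie v w → Bridge v w) (prune : Prune R R′) (balanced : Balanced R c) where

    open Prune prune

    private
      v∈ = proj₁ leaf
      w∈ = proj₁ (proj₂ leaf)
      vw = proj₁ (proj₁ (proj₂ (proj₂ leaf)))
      bridge = tie⇒bridge (proj₁ (proj₂ (proj₂ leaf)))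
      S = proj₁ bridge
      crossing = proj₂ (proj₂ (proj₂ bridge))

    flipped : Vertex → Bool
    flipped x = c x xor lookup S x

    private
      same-side : ∀ {a b} → Adj a b → ¬ (a ≡ v × b ≡ w) → ¬ (a ≡ w × b ≡ v) → lookup S a ≡ lookup S b
      same-side {a} {b} ab ¬vw ¬wv with a ∈? S | b ∈? S
      ... | yes a∈ | yes b∈ = trans ([]=⇒lookup a∈) (sym ([]=⇒lookup b∈))
      ... | no  a∉ | no  b∉ = trans (∉⇒lookup a∉) (sym (∉⇒lookup b∉))
      ... | yes a∈ | no  b∉ = contradiction (crossing a b ab a∈ b∉) ¬vw
      ... | no  a∉ | yes b∈ with crossing b a (adj-sym ab) b∈ a∉
      ...   | b≡v , a≡w = contradiction (a≡w , b≡v) ¬wv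

      module _ {a b} (¬vw : ¬ (a ≡ v × b ≡ w)) (¬wv : ¬ (a ≡ w × b ≡ v)) where

        unflip : Bichromatic flipped a b → Bichromatic c a b
        unflip (ab , ≢) = ab , λ eq → ≢ (cong₂ _xor_ eq (same-side ab ¬vw ¬wv))

        flip : Bichromatic c a b → Bichromatic flipped a b
        flip (ab , ≢) = ab , λ eq → ≢ (xor-cancelʳ (same-side ab ¬vw ¬wv) eq)

      v≢w : v ≢ w
      v≢w eq = adj-irrefl (subst (Adj v) (sym eq) vw)

      -- As `v` is in `R`, balance makes `c` agree on `v` and `w`; flipping on `S` then changes the
      -- colour of `v` alone.
      flipped-vw : flipped v ≢ flipped w
      flipped-vw eq with c v Bool.≟ c w
      ... | no ≢ = proj₁ (balanced v) v∈ w (vw , ≢)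
      ... | yes cv≡cw with trans (sym ([]=⇒lookup (proj₁ (proj₂ bridge))))
             (trans (xor-cancelˡ cv≡cw eq) (∉⇒lookup (proj₁ (proj₂ (proj₂ bridge)))))
        where
        xor-cancelˡ : ∀ {a b k l} → a ≡ b → a xor k ≡ b xor l → k ≡ l
        xor-cancelˡ {a} {b} {k} {l} a≡b eq =
          xor-cancelʳ a≡b (trans (Bool.xor-comm k a) (trans eq (Bool.xor-comm b l)))
      ...   | ()

    -- At `v` and `w`, which had no bichromatic edge, `vw` becomes the only one. Any other vertex
    -- outside `R′` was outside `R` and keeps its unique partner.
    flipped-balanced : Balanced R′ flipped
    flipped-balanced x = inside′ , outside′
      where
      inside′ : x ∈ R′ → ∀ y → ¬ Bichromatic flipped x y
      inside′ x∈ y bi with kept x∈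
      ... | x∈R , x≢v , x≢w = proj₁ (balanced x) x∈R y (unflip (x≢v ∘ proj₁) (x≢w ∘ proj₁) bi)
      outside′ : x ∉ R′ → ∃! _≡_ (Bichromatic flipped x)
      outside′ x∉ with x Fin.≟ v
      ... | yes refl = w , (vw , flipped-vw) , λ {y} bi → decidable-stable (w Fin.≟ y) λ w≢y →
              proj₁ (balanced v) v∈ y (unflip (w≢y ∘ sym ∘ proj₂) (v≢w ∘ proj₁) bi)
      ... | no x≢v with x Fin.≟ w
      ...   | yes refl = v , (adj-sym vw , flipped-vw ∘ sym) , λ {y} bi → decidable-stable (v Fin.≟ y) λ v≢y →
              proj₁ (balanced w) w∈ y (unflip (x≢v ∘ proj₁) (v≢y ∘ sym ∘ proj₂) bi)
      ...   | no x≢w with proj₂ (balanced x) (λ x∈ → x∉ (keeps x∈ x≢v x≢w))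
      ...     | y , bi , unique = y , flip (x≢v ∘ proj₁) (x≢w ∘ proj₁) bi ,
                  λ bi′ → unique (unflip (x≢v ∘ proj₁) (x≢w ∘ proj₁) bi′)

  -- The sides are the two colour classes. The vertex `x₀` serves to make both non-empty: it and its
  -- mate have different colours.
  balanced⇒cut : ∀ {R c} → Balanced R c → (∀ x → x ∉ R) → Vertex → HasPerfectMatchingCut G
  balanced⇒cut {R} {c} balanced empty x₀ = C , record
    { edges     = proj₁
    ; symmetric = λ { (uv , inj₁ (u∈ , v∈)) → adj-sym uv , inj₂ (v∈ , u∈)
                    ; (uv , inj₂ (u∈ , v∈)) → adj-sym uv , inj₁ (v∈ , u∈) }
    ; perfect   = perfect
    }
    where
    X = tabulate c
    X⁻ : ∀ {x} → x ∈ X → c x ≡ true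
    X⁻ {x} x∈ = trans (sym (lookup∘tabulate c x)) ([]=⇒lookup x∈)
    X⁺ : ∀ {x} → c x ≡ true → x ∈ X
    X⁺ {x} eq = lookup⇒[]= x X (trans (lookup∘tabulate c x) eq)
    Y⁻ : ∀ {x} → x ∈ ∁ X → c x ≢ true
    Y⁻ x∈ = x∈∁p⇒x∉p x∈ ∘ X⁺
    Y⁺ : ∀ {x} → c x ≢ true → x ∈ ∁ X
    Y⁺ ≢ = x∉p⇒x∈∁p (≢ ∘ X⁻)
    sides : ∀ x y → c x ≢ c y → (x ∈ X × y ∈ ∁ X) ⊎ (x ∈ ∁ X × y ∈ X)
    sides x y ≢ with c x Bool.≟ true | c y Bool.≟ true
    ... | yes p | no  q = inj₁ (X⁺ p , Y⁺ q)
    ... | no  p | yes q = inj₂ (Y⁺ p , X⁺ q)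
    ... | yes p | yes q = contradiction (trans p (sym q)) ≢
    ... | no  p | no  q = contradiction (trans (Bool.¬-not p) (sym (Bool.¬-not q))) ≢
    mate : ∀ x → ∃! _≡_ (Bichromatic c x)
    mate x = proj₂ (balanced x) (empty x)
    y₀ = proj₁ (mate x₀)
    nonempty : Nonempty X × Nonempty (∁ X)
    nonempty with sides x₀ y₀ (proj₂ (proj₁ (proj₂ (mate x₀))))
    ... | inj₁ (x∈ , y∈) = (x₀ , x∈) , (y₀ , y∈)
    ... | inj₂ (x∈ , y∈) = (y₀ , y∈) , (x₀ , x∈)
    C : Cut G
    C = record
      { X = X ; Y = ∁ X
      ; disjoint = λ (x , x∈) → let (p , q) = x∈p∩q⁻ X (∁ X) x∈ in x∈∁p⇒x∉p q p
      ; covering = p∪∁p≡⊤ X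
      ; X≢∅ = proj₁ nonempty ; Y≢∅ = proj₂ nonempty }
    perfect : ∀ x → ∃! _≡_ (EdgeCut C x)
    perfect x with mate x
    ... | y , (xy , ≢) , unique = y , (xy , sides x y ≢) ,
            λ { (xz , inj₁ (x∈ , z∈)) → unique (xz , λ eq → Y⁻ z∈ (trans (sym eq) (X⁻ x∈)))
              ; (xz , inj₂ (x∈ , z∈)) → unique (xz , λ eq → Y⁻ x∈ (trans eq (X⁻ z∈))) }

  module _ (C : Cut G) (perfectMatching : IsPerfectMatching G (EdgeCut C)) where

    open Cut C
    open IsPerfectMatching perfectMatching renaming (symmetric to M-sym)

    private
      M : Vertex → Vertex → Set
      M = EdgeCut C

      M-functional : ∀ {x y z} → M x y → M x z → y ≡ z
      M-functional {x} xy xz with perfect x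
      ... | _ , _ , unique = trans (sym (unique xy)) (unique xz)

      -- The third vertex `w` is on one of the two sides. The end of `xy` on the opposite side then
      -- has two neighbours across the cut; they coincide, which makes an edge at `w` a loop.
      ¬triangle : ∀ {x y w} → Adj x y → x ∈ X → y ∈ Y → Adj x w → Adj y w → ∀ {A : Set} → A
      ¬triangle {x} {y} {w} xy x∈ y∈ xw yw
        with x∈p∪q⁻ X Y (subst (w ∈_) (sym covering) ∈⊤)
      ... | inj₁ w∈X with refl ← M-functional {y} (adj-sym xy , inj₂ (y∈ , x∈)) (yw , inj₂ (y∈ , w∈X)) =
              ⊥-elim (adj-irrefl xw)
      ... | inj₂ w∈Y with refl ← M-functional {x} (xy , inj₁ (x∈ , y∈)) (xw , inj₁ (x∈ , w∈Y)) =
              ⊥-elim (adj-irrefl yw)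

    M⇒tie : ∀ {x y} → M x y → Tie x y
    M⇒tie (xy , inj₁ (x∈ , y∈)) = xy , λ (w , xw , yw) → ¬triangle xy x∈ y∈ xw yw
    M⇒tie (xy , inj₂ (x∈ , y∈)) = xy , λ (w , xw , yw) → ¬triangle (adj-sym xy) y∈ x∈ yw xw

    -- For a given perfect matching cut, no round has separated a vertex from its mate.
    MateClosed : Subset order → Set
    MateClosed R = ∀ {x y} → x ∈ R → M x y → y ∈ R

    -- The mate of the leaf `v` is in `R` and tied to `v`, hence is `w`. So the round removes a
    -- whole edge of the cut, and no remaining vertex loses its mate.
    prune-closed : ∀ {R R′} → Prune R R′ → MateClosed R → MateClosed R′
    prune-closed {R} prune closed {x} {y} x∈′ xy = keeps (closed x∈ xy)
      (λ { refl → x≢w (unique x∈ (M⇒tie (M-sym xy))) })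
      (λ { refl → x≢v (sym (M-functional (M-sym vw) (M-sym xy))) })
      where
      open Prune prune
      unique = proj₂ (proj₂ (proj₂ leaf))
      x∈  = proj₁ (kept x∈′)
      x≢v = proj₁ (proj₂ (kept x∈′))
      x≢w = proj₂ (proj₂ (kept x∈′))
      vw : M v w
      vw with perfect v
      ... | z , vz , _ = subst (M v) (unique (closed (proj₁ leaf) vz) (M⇒tie vz)) vz

    module _ (tie⇒bridge : ∀ {v w} → Tie v w → Bridge v w) {R} (closed : MateClosed R) (stuck : ∀ v w → ¬ Leaf R v w) where

      private
        -- The mate of `v` is in `R` and tied to it. If all ties of `v` into `R` led to `u`, the
        -- mate would be `u` and `v` would be a leaf.
        another : ∀ {v} u → v ∈ R → ¬ ¬ ∃ λ w → w ∈ R × Tie v w × w ≢ u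
        another {v} u v∈ none with perfect v
        ... | z , vz , _ = stuck v z (v∈ , z∈ , M⇒tie vz , λ x∈ vx → trans (only x∈ vx) (sym (only z∈ (M⇒tie vz))))
          where
          z∈ = closed v∈ vz
          only : ∀ {x} → x ∈ R → Tie v x → x ≡ u
          only {x} x∈ vx = decidable-stable (x Fin.≟ u) λ x≢u → none (x , x∈ , vx , x≢u)

        -- A walk along ties that never turns back can always be continued, yet the part A
        -- of the graph ahead of it keeps shrinking.
        descent : ∀ k {A u v} → ∣ A ∣ ≤ k → Separates v u A → ¬ v ∈ R
        descent k {A} {u} {v} ≤k (v∈A , u∉A , A-crossing) v∈ = another u v∈ next
          where
          next : ¬ ∃ λ w → w ∈ R × Tie v w × w ≢ u
          next (w , w∈ , vw , w≢u) with tie⇒bridge (tie-sym vw)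
          -- The part ahead of `w` is `A ∩ B`. It has lost `v`; and an edge leaving it by leaving
          -- `A` would start at `v`, which is not in `B`.
          ... | B , w∈B , v∉B , B-crossing = go k ≤k
            where
            w∈A : w ∈ A
            w∈A = decidable-stable (w ∈? A) λ w∉A → w≢u (proj₂ (A-crossing v w (proj₁ vw) v∈A w∉A))
            shrinks : ∣ A ∩ B ∣ < ∣ A ∣
            shrinks = p⊂q⇒∣p∣<∣q∣ (p∩q⊆p A B , v , v∈A , v∉B ∘ proj₂ ∘ x∈p∩q⁻ A B)
            crossing : ∀ a b → Adj a b → a ∈ A ∩ B → b ∉ A ∩ B → a ≡ w × b ≡ v
            crossing a b ab a∈ b∉ with x∈p∩q⁻ A B a∈ | b ∈? A
            ... | a∈A , a∈B | yes b∈A = B-crossing a b ab a∈B λ b∈B → b∉ (x∈p∩q⁺ (b∈A , b∈B))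
            ... | a∈A , a∈B | no  b∉A with refl ← proj₁ (A-crossing a b ab a∈A b∉A) = contradiction a∈B v∉B
            go : ∀ k → ¬ ∣ A ∣ ≤ k
            go zero    ≤0 = contradiction (ℕ.≤-trans shrinks ≤0) λ ()
            go (suc k) ≤k = descent k (ℕ.≤-pred (ℕ.≤-trans shrinks ≤k))
              (x∈p∩q⁺ (w∈A , w∈B) , v∉B ∘ proj₂ ∘ x∈p∩q⁻ A B , crossing) w∈

      stuck⇒empty : ∀ x → x ∉ R
      -- The walk has no previous vertex yet, so `x` itself is passed as the vertex to avoid.
      stuck⇒empty x x∈ = another x x∈ λ (w , w∈ , xw , _) →
        descent _ ℕ.≤-refl (proj₂ (tie⇒bridge (tie-sym xw))) w∈

-- A language of bounded loops, its semantics and its running time.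

data Tm : ℕ → Set where
  var     : ∀ {g} → Fin g → Tm g
  nil     : ∀ {g} → Tm g
  cons    : ∀ {g} → Tm g → Tm g → Tm g
  hd tl   : ∀ {g} → Tm g → Tm g
  ifᵗ     : ∀ {g} → Tm g → Tm g → Tm g → Tm g
  letᵗ    : ∀ {g} → Tm g → Tm (suc g) → Tm g
  -- The body sees the accumulator (variable 0) and, in unary, the index (variable 1),
  -- which counts down from n - 1, so that consing onto the accumulator builds a list
  -- in the order of the indices.
  loop    : ∀ {g} → Tm g → Tm (2 + g) → Tm g

num : ℕ → Tree
num zero    = nil
num (suc i) = nil ∙ num i

choose : Tree → Tree → Tree → Tree
choose nil     a b = b
choose (_ ∙ _) a b = a

iter : (ℕ → Tree → Tree) → ℕ → Tree → Tree
iter f zero    acc = acc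
iter f (suc i) acc = iter f i (f i acc)

⟦_⟧ : ∀ {g} → Tm g → ℕ → Vec Tree g → Tree
⟦ var x ⟧     n ρ = lookup ρ x
⟦ nil ⟧       n ρ = nil
⟦ cons t u ⟧  n ρ = ⟦ t ⟧ n ρ ∙ ⟦ u ⟧ n ρ
⟦ hd t ⟧      n ρ = hdᵗ (⟦ t ⟧ n ρ)
⟦ tl t ⟧      n ρ = tlᵗ (⟦ t ⟧ n ρ)
⟦ ifᵗ t u v ⟧ n ρ = choose (⟦ t ⟧ n ρ) (⟦ u ⟧ n ρ) (⟦ v ⟧ n ρ)
⟦ letᵗ t u ⟧  n ρ = ⟦ u ⟧ n (⟦ t ⟧ n ρ ∷ ρ)
⟦ loop t u ⟧  n ρ = iter (λ i acc → ⟦ u ⟧ n (acc ∷ num i ∷ ρ)) n (⟦ t ⟧ n ρ)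

-- The constants are the costs of the commands emitted by `compile`: 2 for copying a register, 3 for
-- `hd` or `tl` of one, 4 for `cons` of two, 2 for a test and 1 for each sequencing. A conditional
-- is charged for both branches, which makes the bound independent of the data.
time : ∀ {g} → Tm g → ℕ → ℕ
time (var x)     n = 2
time nil         n = 2
time (cons t u)  n = 1 + time t n + (1 + time u n + 4)
time (hd t)      n = 1 + time t n + 3
time (tl t)      n = 1 + time t n + 3
time (ifᵗ t u v) n = 1 + time t n + (2 + (time u n + time v n))
time (letᵗ t u)  n = 1 + time t n + (1 + time u n + 2)
time (loop t u)  n = 1 + time t n + (1 + 2 + (n * (2 + (1 + 3 + (1 + time u n + 2))) + 2))

-- Polynomially bounded functions

Poly : (ℕ → ℕ) → Set
Poly f = ∃ λ c → ∃ λ d → ∀ n → f n ≤ c * suc n ^ d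

const-poly : ∀ k → Poly λ _ → k
const-poly k = k , 0 , λ n → ℕ.≤-reflexive (sym (ℕ.*-identityʳ k))

+-poly : ∀ {f g} → Poly f → Poly g → Poly λ n → f n + g n
+-poly {f} {g} (c , d , f≤) (c′ , d′ , g≤) = c + c′ , d + d′ , λ n → begin
  f n + g n                                 ≤⟨ ℕ.+-mono-≤ (f≤ n) (g≤ n) ⟩
  c * suc n ^ d + c′ * suc n ^ d′           ≤⟨ ℕ.+-mono-≤
    -- Exponents can be raised because the base `suc n` is positive, also when `n` is 0.
    (ℕ.*-monoʳ-≤ c (ℕ.^-monoʳ-≤ (suc n) (ℕ.m≤m+n d d′)))
    (ℕ.*-monoʳ-≤ c′ (ℕ.^-monoʳ-≤ (suc n) (ℕ.m≤n+m d′ d))) ⟩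
  c * suc n ^ (d + d′) + c′ * suc n ^ (d + d′) ≡⟨ ℕ.*-distribʳ-+ (suc n ^ (d + d′)) c c′ ⟨
  (c + c′) * suc n ^ (d + d′)               ∎
  where open ℕ.≤-Reasoning

n*-poly : ∀ {f} → Poly f → Poly λ n → n * f n
n*-poly {f} (c , d , f≤) = c , suc d , λ n → begin
  n * f n                   ≤⟨ ℕ.*-mono-≤ (ℕ.n≤1+n n) (f≤ n) ⟩
  suc n * (c * suc n ^ d)   ≡⟨ ℕ.*-assoc (suc n) c _ ⟨
  suc n * c * suc n ^ d     ≡⟨ cong (_* suc n ^ d) (ℕ.*-comm (suc n) c) ⟩
  c * suc n * suc n ^ d     ≡⟨ ℕ.*-assoc c (suc n) _ ⟩
  c * suc n ^ suc d         ∎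
  where open ℕ.≤-Reasoning

time-poly : ∀ {g} (t : Tm g) → Poly (time t)
time-poly (var x)     = const-poly 2
time-poly nil         = const-poly 2
time-poly (cons t u)  = +-poly (+-poly (const-poly 1) (time-poly t)) (+-poly (+-poly (const-poly 1) (time-poly u)) (const-poly 4))
time-poly (hd t)      = +-poly (+-poly (const-poly 1) (time-poly t)) (const-poly 3)
time-poly (tl t)      = +-poly (+-poly (const-poly 1) (time-poly t)) (const-poly 3)
time-poly (ifᵗ t u v) = +-poly (+-poly (const-poly 1) (time-poly t))
  (+-poly (const-poly 2) (+-poly (time-poly u) (time-poly v)))
time-poly (letᵗ t u)  = +-poly (+-poly (const-poly 1) (time-poly t)) (+-poly (+-poly (const-poly 1) (time-poly u)) (const-poly 2))
time-poly (loop t u)  = +-poly (+-poly (const-poly 1) (time-poly t)) (+-poly (const-poly 3)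
  (+-poly (n*-poly (+-poly (const-poly 6) (+-poly (+-poly (const-poly 1) (time-poly u)) (const-poly 2)))) (const-poly 2)))

-- Compilation: register 0 holds the input, register 1 the number n of iterations of a
-- loop, and the value of a term is left in register ℓ, those below ℓ being preserved.

-- The largest register in use.
top : ∀ {g} → Tm g → ℕ → ℕ
top (var x)     ℓ = ℓ
top nil         ℓ = ℓ
top (cons t u)  ℓ = top t ℓ ⊔ top u (suc ℓ)
top (hd t)      ℓ = top t ℓ
top (tl t)      ℓ = top t ℓ
top (ifᵗ t u v) ℓ = top t ℓ ⊔ (top u ℓ ⊔ top v ℓ)
top (letᵗ t u)  ℓ = top t ℓ ⊔ top u (suc ℓ)
top (loop t u)  ℓ = top t ℓ ⊔ top u (2 + ℓ)

ℓ≤top : ∀ {g} (t : Tm g) ℓ → ℓ ≤ top t ℓ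
ℓ≤top (var x)     ℓ = ℕ.≤-refl
ℓ≤top nil         ℓ = ℕ.≤-refl
ℓ≤top (cons t u)  ℓ = ℕ.≤-trans (ℓ≤top t ℓ) (ℕ.m≤m⊔n _ _)
ℓ≤top (hd t)      ℓ = ℓ≤top t ℓ
ℓ≤top (tl t)      ℓ = ℓ≤top t ℓ
ℓ≤top (ifᵗ t u v) ℓ = ℕ.≤-trans (ℓ≤top t ℓ) (ℕ.m≤m⊔n _ _)
ℓ≤top (letᵗ t u)  ℓ = ℕ.≤-trans (ℓ≤top t ℓ) (ℕ.m≤m⊔n _ _)
ℓ≤top (loop t u)  ℓ = ℕ.≤-trans (ℓ≤top t ℓ) (ℕ.m≤m⊔n _ _)

-- Junk value: an index beyond M is sent to register M.
reg : ∀ {M} → ℕ → Fin (suc M)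
reg         zero    = zero
reg {zero}  (suc i) = zero
reg {suc M} (suc i) = suc (reg i)

toℕ-reg : ∀ {M i} → i ≤ M → toℕ (reg {M} i) ≡ i
toℕ-reg z≤n     = refl
toℕ-reg (s≤s p) = cong suc (toℕ-reg p)

module Compiler (M : ℕ) where

  R : ℕ → Fin (suc M)
  R = reg

  R-injective : ∀ {i j} → i ≤ M → j ≤ M → R i ≡ R j → i ≡ j
  R-injective p q eq = trans (sym (toℕ-reg p)) (trans (cong toℕ eq) (toℕ-reg q))

  infix 8 _!_
  _!_ : Store (suc M) → ℕ → Tree
  s ! i = lookup s (R i)

  !-same : ∀ s i {x} → (s [ R i ]≔ x) ! i ≡ x
  !-same s i = lookup∘update (R i) s _

  !-other : ∀ s {i j x} → i ≤ M → j ≤ M → j ≢ i → (s [ R i ]≔ x) ! j ≡ s ! j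
  !-other s i≤ j≤ j≢i = lookup∘update′ (j≢i ∘ R-injective j≤ i≤) s _

  !-below : ∀ s {i j x} → i ≤ M → j < i → (s [ R i ]≔ x) ! j ≡ s ! j
  !-below s i≤ j<i = !-other s i≤ (ℕ.≤-trans (ℕ.<⇒≤ j<i) i≤) (ℕ.<⇒≢ j<i)

  -- Registers from `ℓ` on are used as a stack, and `σ` gives the register of each variable. A loop
  -- keeps its accumulator in `ℓ` and its counter in `suc ℓ`; the counter is lowered before the
  -- body, which therefore sees indices from n - 1 down to 0.
  compile : ∀ {g} → Tm g → Vec ℕ g → ℕ → Cmd (suc M)
  compile (var x)     σ ℓ = R ℓ ≔ var (R (lookup σ x))
  compile nil         σ ℓ = R ℓ ≔ nil
  compile (cons t u)  σ ℓ = compile t σ ℓ ⨾ compile u σ (suc ℓ) ⨾ R ℓ ≔ cons (var (R ℓ)) (var (R (suc ℓ)))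
  compile (hd t)      σ ℓ = compile t σ ℓ ⨾ R ℓ ≔ hd (var (R ℓ))
  compile (tl t)      σ ℓ = compile t σ ℓ ⨾ R ℓ ≔ tl (var (R ℓ))
  compile (ifᵗ t u v) σ ℓ = compile t σ ℓ ⨾ (if var (R ℓ) then compile u σ ℓ else compile v σ ℓ)
  compile (letᵗ t u)  σ ℓ = compile t σ ℓ ⨾ compile u (ℓ ∷ σ) (suc ℓ) ⨾ R ℓ ≔ var (R (suc ℓ))
  compile (loop t u)  σ ℓ = compile t σ ℓ ⨾ R (suc ℓ) ≔ var (R 1) ⨾
    while var (R (suc ℓ)) loop
      (R (suc ℓ) ≔ tl (var (R (suc ℓ))) ⨾ compile u (ℓ ∷ suc ℓ ∷ σ) (2 + ℓ) ⨾ R ℓ ≔ var (R (2 + ℓ)))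

  -- A total correctness triple with postcondition `Q` and time bound `b`.
  Exec : Cmd (suc M) → Store (suc M) → ℕ → (Store (suc M) → Set) → Set
  Exec c s b Q = ∃ λ t → ∃ λ s′ → t ≤ b × (⟨ c , s ⟩⇓[ t ] s′) × Q s′

  exec-mono : ∀ {c s b b′} {Q Q′ : Store (suc M) → Set} → b ≤ b′ → (∀ {s′} → Q s′ → Q′ s′) →
              Exec c s b Q → Exec c s b′ Q′
  exec-mono b≤ f (t , s′ , t≤ , c⇓ , q) = t , s′ , ℕ.≤-trans t≤ b≤ , c⇓ , f q

  exec-assign : ∀ {x e s} {Q : Store (suc M) → Set} → Q (s [ x ]≔ eval e s) → Exec (x ≔ e) s (1 + cost e) Q
  exec-assign q = _ , _ , ℕ.≤-refl , ⇓-assign , q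

  exec-seq : ∀ {c d s b b′} {Q Q′ : Store (suc M) → Set} →
             Exec c s b Q → (∀ {s′} → Q s′ → Exec d s′ b′ Q′) → Exec (c ⨾ d) s (1 + b + b′) Q′
  exec-seq (t , s′ , t≤ , c⇓ , q) f with f q
  ... | t′ , s″ , t′≤ , d⇓ , q′ = _ , s″ , s≤s (ℕ.+-mono-≤ t≤ t′≤) , ⇓-seq c⇓ d⇓ , q′

  -- All registers that must survive, including the clock in register 1, are below `ℓ`, where code
  -- compiled at `ℓ` does not write.
  record Env {g} (n : ℕ) (s : Store (suc M)) (σ : Vec ℕ g) (ℓ : ℕ) (ρ : Vec Tree g) : Set where
    field
      clock  : s ! 1 ≡ num n
      1<     : 1 < ℓ
      below  : ∀ x → lookup σ x < ℓ
      agrees : ∀ x → s ! lookup σ x ≡ lookup ρ x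

  record Frame (ℓ : ℕ) (s s′ : Store (suc M)) : Set where
    constructor unchanged
    field
      at : ∀ {r} → r < ℓ → s′ ! r ≡ s ! r

  open Frame

  frame-trans : ∀ {ℓ ℓ′ s₀ s₁ s₂} → ℓ ≤ ℓ′ → Frame ℓ s₀ s₁ → Frame ℓ′ s₁ s₂ → Frame ℓ s₀ s₂
  frame-trans ℓ≤ f g = unchanged λ r< → trans (at g (ℕ.<-≤-trans r< ℓ≤)) (at f r<)

  frame-restrict : ∀ {ℓ ℓ′ s s′} → ℓ ≤ ℓ′ → Frame ℓ′ s s′ → Frame ℓ s s′
  frame-restrict ℓ≤ f = unchanged λ r< → at f (ℕ.<-≤-trans r< ℓ≤)

  frame-assign : ∀ s {ℓ x} → ℓ ≤ M → Frame ℓ s (s [ R ℓ ]≔ x)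
  frame-assign s ℓ≤ = unchanged (!-below s ℓ≤)

  Result : Store (suc M) → ℕ → Tree → Store (suc M) → Set
  Result s ℓ x s′ = s′ ! ℓ ≡ x × Frame ℓ s s′

  module _ {g n s} {σ : Vec ℕ g} {ℓ ρ} (env : Env n s σ ℓ ρ) where

    open Env env

    env-frame : ∀ {s′} → Frame ℓ s s′ → Env n s′ σ ℓ ρ
    env-frame frame = record
      { clock  = trans (at frame 1<) clock
      ; 1<     = 1<
      ; below  = below
      ; agrees = λ x → trans (at frame (below x)) (agrees x)
      }

    env-suc : Env n s σ (suc ℓ) ρ
    env-suc = record { clock = clock ; 1< = ℕ.m<n⇒m<1+n 1< ; below = ℕ.m<n⇒m<1+n ∘ below ; agrees = agrees }

    env-push : ∀ {x} → s ! ℓ ≡ x → Env n s (ℓ ∷ σ) (suc ℓ) (x ∷ ρ)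
    env-push eq = record
      { clock  = clock
      ; 1<     = ℕ.m<n⇒m<1+n 1<
      ; below  = λ { zero → ℕ.≤-refl ; (suc x) → ℕ.m<n⇒m<1+n (below x) }
      ; agrees = λ { zero → eq ; (suc x) → agrees x }
      }

  compile-correct : ∀ {g n s} (t : Tm g) {σ ℓ ρ} → Env n s σ ℓ ρ → top t ℓ ≤ M →
                    Exec (compile t σ ℓ) s (time t n) (Result s ℓ (⟦ t ⟧ n ρ))

  private
    return : ∀ {s₀ s ℓ x e} → ℓ ≤ M → Frame ℓ s₀ s → eval e s ≡ x →
             Exec (R ℓ ≔ e) s (1 + cost e) (Result s₀ ℓ x)
    return {s = s} ≤M frame eq = exec-assign (trans (!-same s _) eq , frame-trans ℕ.≤-refl frame (frame-assign s ≤M))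

    -- Induction on the number `k` of rounds left, with the accumulator arbitrary; proved together
    -- with `compile-correct`, which handles the body.
    while-correct : ∀ {g n} (u : Tm (2 + g)) {σ : Vec ℕ g} {ℓ ρ} → top u (2 + ℓ) ≤ M →
      ∀ k {s acc} → Env n s σ ℓ ρ → s ! ℓ ≡ acc → s ! suc ℓ ≡ num k →
      Exec (while var (R (suc ℓ)) loop
             (R (suc ℓ) ≔ tl (var (R (suc ℓ))) ⨾ compile u (ℓ ∷ suc ℓ ∷ σ) (2 + ℓ) ⨾ R ℓ ≔ var (R (2 + ℓ))))
           s (k * (2 + (1 + 3 + (1 + time u n + 2))) + 2)
           (Result s ℓ (iter (λ i acc → ⟦ u ⟧ n (acc ∷ num i ∷ ρ)) k acc))

  compile-correct (var x) env ≤M = return ≤M (unchanged λ _ → refl) (Env.agrees env x)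
  compile-correct nil env ≤M = return ≤M (unchanged λ _ → refl) refl
  compile-correct (cons t u) {ℓ = ℓ} env ≤M =
    exec-seq (compile-correct t env t≤) λ {s₁} (t-eq , t-frame) →
    exec-seq (compile-correct u (env-suc (env-frame env t-frame)) u≤) λ (u-eq , u-frame) →
    return (ℕ.≤-trans (ℓ≤top t ℓ) t≤) (frame-trans (ℕ.n≤1+n _) t-frame u-frame)
      (cong₂ _∙_ (trans (at u-frame ℕ.≤-refl) t-eq) u-eq)
    where
    t≤ = ℕ.m⊔n≤o⇒m≤o _ _ ≤M
    u≤ = ℕ.m⊔n≤o⇒n≤o (top t ℓ) _ ≤M
  compile-correct (hd t) {ℓ = ℓ} env ≤M =
    exec-seq (compile-correct t env ≤M) λ (eq , frame) → return (ℕ.≤-trans (ℓ≤top t ℓ) ≤M) frame (cong hdᵗ eq)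
  compile-correct (tl t) {ℓ = ℓ} env ≤M =
    exec-seq (compile-correct t env ≤M) λ (eq , frame) → return (ℕ.≤-trans (ℓ≤top t ℓ) ≤M) frame (cong tlᵗ eq)
  compile-correct {n = n} (ifᵗ t u v) {σ} {ℓ} {ρ} env ≤M =
    exec-seq (compile-correct t env (ℕ.m⊔n≤o⇒m≤o _ _ ≤M)) branch
    where
    uv≤ = ℕ.m⊔n≤o⇒n≤o (top t ℓ) _ ≤M
    branch : ∀ {s₁} → Result _ ℓ (⟦ t ⟧ n ρ) s₁ →
      Exec (if var (R ℓ) then compile u σ ℓ else compile v σ ℓ) s₁ (2 + (time u n + time v n))
           (Result _ ℓ (⟦ ifᵗ t u v ⟧ n ρ))
    branch (eq , frame) with ⟦ t ⟧ n ρ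
    ... | nil with compile-correct v (env-frame env frame) (ℕ.m⊔n≤o⇒n≤o (top u ℓ) _ uv≤)
    ...   | _ , s′ , t≤ , v⇓ , (v-eq , v-frame) =
              _ , s′ , s≤s (s≤s (ℕ.≤-trans t≤ (ℕ.m≤n+m _ _))) , ⇓-if-false eq v⇓ ,
              (v-eq , frame-trans ℕ.≤-refl frame v-frame)
    branch (eq , frame) | _ ∙ _ with compile-correct u (env-frame env frame) (ℕ.m⊔n≤o⇒m≤o _ _ uv≤)
    ...   | _ , s′ , t≤ , u⇓ , (u-eq , u-frame) =
              _ , s′ , s≤s (s≤s (ℕ.≤-trans t≤ (ℕ.m≤m+n _ _))) , ⇓-if-true eq u⇓ ,
              (u-eq , frame-trans ℕ.≤-refl frame u-frame)
  compile-correct (letᵗ t u) {ℓ = ℓ} env ≤M =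
    exec-seq (compile-correct t env t≤) λ (t-eq , t-frame) →
    exec-seq (compile-correct u (env-push (env-frame env t-frame) t-eq) u≤) λ (u-eq , u-frame) →
    return (ℕ.≤-trans (ℓ≤top t ℓ) t≤) (frame-trans (ℕ.n≤1+n _) t-frame u-frame) u-eq
    where
    t≤ = ℕ.m⊔n≤o⇒m≤o _ _ ≤M
    u≤ = ℕ.m⊔n≤o⇒n≤o (top t ℓ) _ ≤M
  compile-correct {n = n} (loop t u) {ℓ = ℓ} env ≤M =
    exec-seq (compile-correct t env t≤) λ {s₁} (t-eq , t-frame) →
    exec-seq (exec-assign {Q = λ s₂ → s₂ ! suc ℓ ≡ num n × Frame (suc ℓ) s₁ s₂}
      (trans (!-same s₁ (suc ℓ)) (Env.clock (env-frame env t-frame)) , frame-assign s₁ sucℓ≤)) λ (clock-eq , frame) →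
    exec-mono ℕ.≤-refl (λ (eq , while-frame) → eq ,
        frame-trans ℕ.≤-refl (frame-trans (ℕ.n≤1+n _) t-frame frame) while-frame)
      (while-correct u u≤ n (env-frame env (frame-trans (ℕ.n≤1+n _) t-frame frame))
        (trans (at frame ℕ.≤-refl) t-eq) clock-eq)
    where
    t≤ = ℕ.m⊔n≤o⇒m≤o _ _ ≤M
    u≤ = ℕ.m⊔n≤o⇒n≤o (top t ℓ) _ ≤M
    sucℓ≤ : suc ℓ ≤ M
    sucℓ≤ = ℕ.≤-trans (ℕ.n≤1+n _) (ℕ.≤-trans (ℓ≤top u (2 + ℓ)) u≤)

  while-correct u u≤ zero env acc-eq idx-eq =
    _ , _ , ℕ.≤-refl , ⇓-while-false idx-eq , acc-eq , unchanged λ _ → refl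
  while-correct {n = n} u {σ} {ℓ} {ρ} u≤ (suc k) {s} {acc} env acc-eq idx-eq with body
    where
    2+ℓ≤ : 2 + ℓ ≤ M
    2+ℓ≤ = ℕ.≤-trans (ℓ≤top u (2 + ℓ)) u≤
    1+ℓ≤ = ℕ.≤-trans (ℕ.n≤1+n _) 2+ℓ≤
    ℓ≤ = ℕ.≤-trans (ℕ.n≤1+n _) 1+ℓ≤
    body : Exec (R (suc ℓ) ≔ tl (var (R (suc ℓ))) ⨾ compile u (ℓ ∷ suc ℓ ∷ σ) (2 + ℓ) ⨾ R ℓ ≔ var (R (2 + ℓ)))
      s (1 + 3 + (1 + time u n + 2))
      (λ s′ → Result s ℓ (⟦ u ⟧ n (acc ∷ num k ∷ ρ)) s′ × s′ ! suc ℓ ≡ num k)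
    body =
      exec-seq (exec-assign {Q = λ s₁ → s₁ ! suc ℓ ≡ num k × Frame (suc ℓ) s s₁}
        (trans (!-same s (suc ℓ)) (cong tlᵗ idx-eq) , frame-assign s 1+ℓ≤)) λ {s₁} (idx-eq′ , frame) →
      exec-seq (compile-correct u {σ = ℓ ∷ suc ℓ ∷ σ}
        (env-swap (env-frame env (frame-restrict (ℕ.n≤1+n _) frame)) (trans (at frame ℕ.≤-refl) acc-eq) idx-eq′)
        u≤) λ {s₂} (u-eq , u-frame) →
      exec-assign
        ( (trans (!-same s₂ ℓ) u-eq
          , frame-trans ℕ.≤-refl
              (frame-trans (ℕ.m≤n+m ℓ 2) (frame-restrict (ℕ.n≤1+n _) frame) u-frame) (frame-assign s₂ ℓ≤))
        , trans (!-other s₂ ℓ≤ 1+ℓ≤ ℕ.1+n≢n) (trans (at u-frame ℕ.≤-refl) idx-eq′))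
      where
      env-swap : ∀ {s x y} → Env n s σ ℓ ρ → s ! ℓ ≡ x → s ! suc ℓ ≡ y →
                 Env n s (ℓ ∷ suc ℓ ∷ σ) (2 + ℓ) (x ∷ y ∷ ρ)
      env-swap env p q = record
        { clock  = clock
        ; 1<     = ℕ.m<n⇒m<1+n (ℕ.m<n⇒m<1+n 1<)
        ; below  = λ { zero → ℕ.n≤1+n _ ; (suc zero) → ℕ.≤-refl
                     ; (suc (suc x)) → ℕ.m<n⇒m<1+n (ℕ.m<n⇒m<1+n (below x)) }
        ; agrees = λ { zero → p ; (suc zero) → q ; (suc (suc x)) → agrees x }
        }
        where open Env env
  ... | t , s′ , t≤ , body⇓ , ((acc-eq′ , frame) , idx-eq′)
    with while-correct u u≤ k (env-frame env frame) acc-eq′ idx-eq′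
  ...   | t′ , s″ , t′≤ , while⇓ , (eq , frame′) =
    _ , s″ , bound , ⇓-while-true idx-eq body⇓ while⇓ , (eq , frame-trans ℕ.≤-refl frame frame′)
    where
    B = 1 + 3 + (1 + time u n + 2)
    bound : 1 + 1 + t + t′ ≤ suc k * (2 + B) + 2
    bound = ℕ.≤-trans (ℕ.+-mono-≤ (s≤s (s≤s t≤)) t′≤) (ℕ.≤-reflexive (sym (ℕ.+-assoc (2 + B) (k * (2 + B)) 2)))

-- From terms to programs deciding in polynomial time.

spine : Tree → ℕ
spine nil     = 0
spine (_ ∙ t) = suc (spine t)

spine<size : ∀ t → spine t < size t
spine<size nil     = ℕ.≤-refl
spine<size (a ∙ t) = s≤s (ℕ.≤-trans (spine<size t) (ℕ.m≤n+m (size t) (size a)))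

module _ (t : Tm 1) where

  private
    M = top t 2

  open Compiler M
  open Frame

  -- Sets the clock to the length of the input list, which for an adjacency matrix is the order of
  -- the graph. Register 2 is consumed in place of the input.
  prologue : Cmd (suc M)
  prologue = R 2 ≔ var (R 0) ⨾ while var (R 2) loop (R 1 ≔ cons nil (var (R 1)) ⨾ R 2 ≔ tl (var (R 2)))

  program : Program
  program = record { auxiliary = M ; body = prologue ⨾ compile t (0 ∷ []) 2 ⨾ R 0 ≔ var (R 2) }

  -- Each round of the prologue costs 10: 2 for the test and 8 for the two assignments with their
  -- sequencing.
  program-time : ℕ → ℕ
  program-time n = 1 + (3 + (n * 10 + 2)) + (1 + time t n + 2)

  program-time-poly : Poly program-time
  program-time-poly = +-poly
    (+-poly (const-poly 1) (+-poly (const-poly 3) (+-poly (n*-poly (const-poly 10)) (const-poly 2))))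
    (+-poly (+-poly (const-poly 1) (time-poly t)) (const-poly 2))

  private
    2≤M : 2 ≤ M
    2≤M = ℓ≤top t 2

    1≤M : 1 ≤ M
    1≤M = ℕ.≤-trans (s≤s z≤n) 2≤M

    Counted : Store (suc M) → ℕ → Store (suc M) → Set
    Counted s m s′ = s′ ! 1 ≡ num m × Frame 1 s s′

    count : ∀ w {s m} → s ! 2 ≡ w → s ! 1 ≡ num m →
      Exec (while var (R 2) loop (R 1 ≔ cons nil (var (R 1)) ⨾ R 2 ≔ tl (var (R 2)))) s (spine w * 10 + 2)
        (Counted s (spine w + m))
    count nil w-eq m-eq = _ , _ , ℕ.≤-refl , ⇓-while-false w-eq , m-eq , unchanged λ _ → refl
    count (a ∙ w) {s} {m} w-eq m-eq with body
      where
      body : Exec (R 1 ≔ cons nil (var (R 1)) ⨾ R 2 ≔ tl (var (R 2))) s 8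
               (λ s′ → s′ ! 2 ≡ w × Counted s (suc m) s′)
      body = exec-seq (exec-assign {Q = λ s′ → s′ ! 2 ≡ a ∙ w × Counted s (suc m) s′}
          ( trans (!-other s 1≤M 2≤M λ ()) w-eq
          , trans (!-same s 1) (cong (nil ∙_) m-eq) , frame-assign s 1≤M))
        λ {s₁} (w-eq₁ , m-eq₁ , frame) → exec-assign
          ( trans (!-same s₁ 2) (cong tlᵗ w-eq₁)
          , trans (!-other s₁ 2≤M 1≤M λ ()) m-eq₁
          , frame-trans (s≤s z≤n) frame (frame-assign s₁ 2≤M))
    ... | τ , s′ , τ≤ , body⇓ , (w-eq′ , m-eq′ , frame) with count w w-eq′ m-eq′
    ...   | τ′ , s″ , τ′≤ , while⇓ , (eq , frame′) =
      _ , s″ , s≤s (s≤s (ℕ.+-mono-≤ τ≤ τ′≤)) , ⇓-while-true w-eq body⇓ while⇓ ,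
      trans eq (cong num (ℕ.+-suc (spine w) m)) , frame-trans ℕ.≤-refl frame frame′

  program-correct : ∀ i → ∃ λ τ → τ ≤ program-time (spine i) × Run program i τ (⟦ t ⟧ (spine i) (i ∷ []))
  program-correct i = finish exec
    where
    n = spine i
    s₀ : Store (suc M)
    s₀ = i ∷ replicate M nil
    ⟦t⟧ = ⟦ t ⟧ n (i ∷ [])
    -- `M` is not visibly a successor; generalised to `m`, it becomes one on matching `1 ≤ m`, and
    -- `reg` reduces.
    nil! : ∀ {m} k → 1 ≤ m → lookup (i ∷ replicate m nil) (reg (suc k)) ≡ nil
    nil! k (s≤s {n = m} _) = lookup-replicate (reg k) nil
    environment : ∀ {s} → Counted s₀ n s → Env n s (0 ∷ []) 2 (i ∷ [])
    environment (eq , frame) = record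
      { clock  = eq
      ; 1<     = ℕ.≤-refl
      ; below  = λ { zero → s≤s z≤n }
      ; agrees = λ { zero → at frame (s≤s z≤n) }
      }
    exec : Exec (prologue ⨾ compile t (0 ∷ []) 2 ⨾ R 0 ≔ var (R 2)) s₀ (program-time n) (λ s → s ! 0 ≡ ⟦t⟧)
    exec = exec-seq
      (exec-seq (exec-assign {Q = λ s → s ! 2 ≡ i × s ! 1 ≡ num 0 × Frame 1 s₀ s}
          (!-same s₀ 2 , trans (!-other s₀ 2≤M 1≤M λ ()) (nil! 0 1≤M) , frame-restrict (s≤s z≤n) (frame-assign s₀ 2≤M)))
        λ (w-eq , m-eq , frame) → exec-mono ℕ.≤-refl
          (λ (eq , frame′) → trans eq (cong num (ℕ.+-identityʳ n)) , frame-trans ℕ.≤-refl frame frame′)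
          (count i w-eq m-eq))
      λ counted → exec-seq (compile-correct t (environment counted) ℕ.≤-refl)
        λ {s} (eq , _) → exec-assign (trans (!-same s 0) eq)
    finish : Exec (prologue ⨾ compile t (0 ∷ []) 2 ⨾ R 0 ≔ var (R 2)) s₀ (program-time n) (λ s → s ! 0 ≡ ⟦t⟧) →
             ∃ λ τ → τ ≤ program-time n × Run program i τ ⟦t⟧
    finish (τ , (x ∷ s) , τ≤ , run , eq) = τ , τ≤ , (x ∷ s) , run , eq

computes⇒polyTimeDecidable : ∀ {A : Set} {encode : A → Tree} {Promise P : A → Set} (t : Tm 1) →
  (∀ a → Promise a → Σ (Dec (P a)) λ P? → ⟦ t ⟧ (spine (encode a)) (encode a ∷ []) ≡ encodeBool (does P?)) →
  PolyTimeDecidable encode Promise P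
computes⇒polyTimeDecidable {encode = encode} {P = P} t computes =
  program t , c , d , λ a promise → decide a (computes a promise)
  where
  c = proj₁ (program-time-poly t)
  d = proj₁ (proj₂ (program-time-poly t))
  bound : ∀ {τ} i → τ ≤ program-time t (spine i) → τ ≤ c * size i ^ d + c
  bound {τ} i τ≤ = begin
    τ                            ≤⟨ τ≤ ⟩
    program-time t (spine i)     ≤⟨ proj₂ (proj₂ (program-time-poly t)) (spine i) ⟩
    c * suc (spine i) ^ d        ≤⟨ ℕ.*-monoʳ-≤ c (ℕ.^-monoˡ-≤ d (spine<size i)) ⟩
    c * size i ^ d               ≤⟨ ℕ.m≤m+n _ c ⟩
    c * size i ^ d + c           ∎
    where open ℕ.≤-Reasoning
  decide : ∀ a → (Σ (Dec (P a)) λ P? → ⟦ t ⟧ (spine (encode a)) (encode a ∷ []) ≡ encodeBool (does P?)) →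
           ∃ λ τ → τ ≤ c * size (encode a) ^ d + c ×
             Σ (Dec (P a)) λ P? → Run (program t) (encode a) τ (encodeBool (does P?))
  decide a (P? , eq) =
    let τ , τ≤ , run = program-correct t (encode a)
    in τ , bound (encode a) τ≤ , P? , subst (Run (program t) (encode a) τ) eq run

-- Trees as truth values, lists and numbers.

truth : Tree → Bool
truth nil     = false
truth (_ ∙ _) = true

Decides : Set → Tree → Set
Decides P t = Reflects P (truth t)

reflects-map : ∀ {P Q : Set} {b} → (P → Q) → (Q → P) → Reflects P b → Reflects Q b
reflects-map f g (ofʸ p)  = ofʸ (f p)
reflects-map f g (ofⁿ ¬p) = ofⁿ (¬p ∘ g)

reflects-⇒ : ∀ {P Q : Set} {b} → Reflects P b → Reflects Q b → P → Q
reflects-⇒ (ofʸ _)  (ofʸ q) _ = q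
reflects-⇒ (ofⁿ ¬p) (ofⁿ _) p = contradiction p ¬p

truth-encodeBool : ∀ b → truth (encodeBool b) ≡ b
truth-encodeBool false = refl
truth-encodeBool true  = refl

choose-∧ : ∀ {P Q s t} → Decides P s → Decides Q t → Decides (P × Q) (choose s t nil)
choose-∧ {s = nil}   (ofⁿ ¬p) q = ofⁿ (¬p ∘ proj₁)
choose-∧ {s = _ ∙ _} (ofʸ p)  q = reflects-map (p ,_) proj₂ q

choose-∨ : ∀ {P Q s t} → Decides P s → Decides Q t → Decides (P ⊎ Q) (choose s (nil ∙ nil) t)
choose-∨ {s = nil}   (ofⁿ ¬p) q = reflects-map inj₂ (λ { (inj₁ p) → contradiction p ¬p ; (inj₂ q) → q }) q
choose-∨ {s = _ ∙ _} (ofʸ p)  q = ofʸ (inj₁ p)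

choose-¬ : ∀ {P s} → Decides P s → Decides (¬ P) (choose s nil (nil ∙ nil))
choose-¬ {s = nil}   (ofⁿ ¬p) = ofʸ ¬p
choose-¬ {s = _ ∙ _} (ofʸ p)  = ofⁿ λ ¬p → ¬p p

dropT : ℕ → Tree → Tree
dropT zero    t = t
dropT (suc i) t = dropT i (tlᵗ t)

bit : Tree → ℕ → Tree
bit t i = hdᵗ (dropT i t)

dropT-tl : ∀ i t → dropT (suc i) t ≡ tlᵗ (dropT i t)
dropT-tl zero    t = refl
dropT-tl (suc i) t = dropT-tl i (tlᵗ t)

dropT-num : ∀ j i → dropT j (num i) ≡ num (i ∸ j)
dropT-num zero    i       = refl
dropT-num (suc j) zero    = trans (dropT-num j 0) (cong num (ℕ.0∸n≡0 j))
dropT-num (suc j) (suc i) = dropT-num j i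

bit-encodeList : ∀ {n} {A : Set} (enc : A → Tree) (f : Fin n → A) v →
                 bit (encodeList enc (L.tabulate f)) (toℕ v) ≡ enc (f v)
bit-encodeList enc f zero    = refl
bit-encodeList enc f (suc v) = bit-encodeList enc (f ∘ suc) v

nonempty-encodeList : ∀ {n} {A : Set} (enc : A → Tree) (f : Fin n → A) →
                      Decides (Fin n) (encodeList enc (L.tabulate f))
nonempty-encodeList {zero}  enc f = ofⁿ λ ()
nonempty-encodeList {suc n} enc f = ofʸ zero

spine-encodeList : ∀ {n} {A : Set} (enc : A → Tree) (f : Fin n → A) →
                   spine (encodeList enc (L.tabulate f)) ≡ n
spine-encodeList {zero}  enc f = refl
spine-encodeList {suc n} enc f = cong suc (spine-encodeList enc (f ∘ suc))

-- The algorithm as a term, and its building blocks.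

module _ {g : ℕ} where

  trueᵗ : Tm g
  trueᵗ = cons nil nil

  notᵗ : Tm g → Tm g
  notᵗ t = ifᵗ t nil trueᵗ

  infixr 6 _andᵗ_
  _andᵗ_ : Tm g → Tm g → Tm g
  t andᵗ u = ifᵗ t u nil

  anyᵗ : Tm (2 + g) → Tm g
  anyᵗ u = loop nil (ifᵗ u (cons nil nil) (var zero))

  -- The additional cons tells index 0 from failure.
  findᵗ : Tm (2 + g) → Tm g
  findᵗ u = loop nil (ifᵗ u (cons nil (var (suc zero))) (var zero))

  tabulateᵗ : Tm (2 + g) → Tm g
  tabulateᵗ u = loop nil (cons u (var zero))

  -- As loops always run n times, the accumulator pairs the list with the number of tails still to
  -- be taken; once that is `nil`, the remaining rounds do nothing.
  dropᵗ : Tm g → Tm g → Tm g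
  dropᵗ t u = hd (loop (cons t u)
    (ifᵗ (tl (var zero)) (cons (tl (hd (var zero))) (tl (tl (var zero)))) (var zero)))

  bitᵗ : Tm g → Tm g → Tm g
  bitᵗ t u = hd (dropᵗ t u)

  -- On unary numbers, dropᵗ is truncated subtraction.
  eqᵗ : Tm g → Tm g → Tm g
  eqᵗ t u = notᵗ (dropᵗ t u) andᵗ notᵗ (dropᵗ u t)

i₀ i₁ : ∀ {g} → Fin (2 + g)
i₀ = zero
i₁ = suc zero

up : ∀ {g} → Fin g → Fin (2 + g)
up x = suc (suc x)

adjᵗ : ∀ {g} → Fin g → Fin g → Fin g → Tm g
adjᵗ A u v = bitᵗ (bitᵗ (var A) (var u)) (var v)

tieᵗ : ∀ {g} → Fin g → Fin g → Fin g → Tm g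
tieᵗ A u v = adjᵗ A u v andᵗ notᵗ (anyᵗ (adjᵗ (up A) (up u) i₁ andᵗ adjᵗ (up A) (up v) i₁))

leafᵗ : ∀ {g} → Fin g → Fin g → Fin g → Tm g
leafᵗ A R v = bitᵗ (var R) (var v) andᵗ
  anyᵗ (bitᵗ (var (up R)) (var i₁) andᵗ tieᵗ (up A) (up v) i₁ andᵗ
        notᵗ (anyᵗ (bitᵗ (var (up (up R))) (var i₁) andᵗ tieᵗ (up (up A)) (up (up v)) i₁ andᵗ
                    notᵗ (eqᵗ (var i₁) (var (up i₁))))))

-- Only the leaf is searched for. Its single tie into the remaining set leads to its partner, so
-- deleting the leaf and all vertices tied to it deletes exactly the pair.
pruneᵗ : ∀ {g} → Fin g → Fin g → Tm g
pruneᵗ A R = letᵗ (findᵗ (leafᵗ (up A) (up R) i₁)) (ifᵗ (var zero)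
  (letᵗ (tl (var zero)) (tabulateᵗ
    (bitᵗ (var (up (up R))) (var i₁) andᵗ notᵗ (eqᵗ (var i₁) (var (up zero))) andᵗ
     notᵗ (tieᵗ (up (up A)) (up zero) i₁))))
  (var (suc R)))

greedyᵗ : Tm 1
greedyᵗ = loop (tabulateᵗ trueᵗ) (pruneᵗ (up zero) i₀)

-- The outer test rejects the graph without vertices, which leaves nothing unmatched but has no cut.
matchingᵗ : Tm 1
matchingᵗ = ifᵗ (var zero) (notᵗ (letᵗ greedyᵗ (anyᵗ (bitᵗ (var (up zero)) (var i₁))))) nil

-- A record, so that the term t can be inferred from the type.
record Decided {g} (n : ℕ) (ρ : Vec Tree g) (t : Tm g) (P : Set) : Set where
  constructor decided
  field
    decides : Decides P (⟦ t ⟧ n ρ)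

open Decided

decided-map : ∀ {g n P Q} {ρ : Vec Tree g} {t} → (P → Q) → (Q → P) → Decided n ρ t P → Decided n ρ t Q
decided-map f g (decided p) = decided (reflects-map f g p)

decided-∧ : ∀ {g n P Q} {ρ : Vec Tree g} {t u} →
            Decided n ρ t P → Decided n ρ u Q → Decided n ρ (t andᵗ u) (P × Q)
decided-∧ (decided p) (decided q) = decided (choose-∧ p q)

decided-¬ : ∀ {g n P} {ρ : Vec Tree g} {t} → Decided n ρ t P → Decided n ρ (notᵗ t) (¬ P)
decided-¬ (decided p) = decided (choose-¬ p)

drop-loop : ∀ k {i} l → i ≤ k →
  iter (λ _ acc → choose (tlᵗ acc) (tlᵗ (hdᵗ acc) ∙ tlᵗ (tlᵗ acc)) acc) k (l ∙ num i) ≡ dropT i l ∙ nil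
drop-loop zero    l z≤n     = refl
drop-loop (suc k) l z≤n     = drop-loop k l z≤n
drop-loop (suc k) l (s≤s p) = drop-loop k (tlᵗ l) p

module _ {g n : ℕ} (ρ : Vec Tree g) where

  private
    Value : Tm g → Fin n → Set
    Value t v = ⟦ t ⟧ n ρ ≡ num (toℕ v)

  drop-value : ∀ t u {v} → Value u v → ⟦ dropᵗ t u ⟧ n ρ ≡ dropT (toℕ v) (⟦ t ⟧ n ρ)
  drop-value t u {v} eq rewrite eq = cong hdᵗ (drop-loop n (⟦ t ⟧ n ρ) (ℕ.<⇒≤ (Fin.toℕ<n v)))

  bit-value : ∀ t u {v} → Value u v → ⟦ bitᵗ t u ⟧ n ρ ≡ bit (⟦ t ⟧ n ρ) (toℕ v)
  bit-value t u eq = cong hdᵗ (drop-value t u eq)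

  ≤-decides : ∀ t u {v w} → Value t v → Value u w → Decided n ρ (notᵗ (dropᵗ t u)) (toℕ v ≤ toℕ w)
  ≤-decides t u {v} {w} v-eq w-eq = decided ≤
    where
    ≤ : Decides (toℕ v ≤ toℕ w) (⟦ notᵗ (dropᵗ t u) ⟧ n ρ)
    ≤ rewrite drop-value t u w-eq | v-eq | dropT-num (toℕ w) (toℕ v)
      with toℕ v ∸ toℕ w in eq
    ... | zero  = ofʸ (ℕ.m∸n≡0⇒m≤n eq)
    ... | suc _ = ofⁿ λ v≤w → ℕ.1+n≢0 (trans (sym eq) (ℕ.m≤n⇒m∸n≡0 v≤w))

  eq-decides : ∀ t u {v w} → Value t v → Value u w → Decided n ρ (eqᵗ t u) (v ≡ w)
  eq-decides t u v-eq w-eq = decided-map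
    (λ (p , q) → Fin.toℕ-injective (ℕ.≤-antisym p q)) (λ { refl → ℕ.≤-refl , ℕ.≤-refl })
    (decided-∧ (≤-decides t u v-eq w-eq) (≤-decides u t w-eq v-eq))

  module _ {P : Fin n → Set} {u : Tm (2 + g)}
           (u-decides : ∀ acc v → Decided n (acc ∷ num (toℕ v) ∷ ρ) u (P v)) where

    private
      decides< : ∀ {k} (k<n : k < n) acc → Decides (P (fromℕ< k<n)) (⟦ u ⟧ n (acc ∷ num k ∷ ρ))
      decides< k<n acc = subst (λ i → Decides (P (fromℕ< k<n)) (⟦ u ⟧ n (acc ∷ num i ∷ ρ)))
        (Fin.toℕ-fromℕ< k<n) (decides (u-decides acc (fromℕ< k<n)))

      last : ∀ {k} (k<n : k < n) (Q : Fin n → Set) → Q (fromℕ< k<n) → (∀ v → toℕ v < k → Q v) →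
             ∀ v → toℕ v < suc k → Q v
      last k<n Q q below v v< with ℕ.m≤n⇒m<n∨m≡n (ℕ.≤-pred v<)
      ... | inj₁ v<k  = below v v<k
      ... | inj₂ refl = subst Q (Fin.fromℕ<-toℕ v k<n) q

      -- The accumulator decides an arbitrary `Q`, since the round with index `k` replaces `Q` by
      -- the disjunction of `P` at `k` with `Q`.
      any-loop : ∀ k → k ≤ n → ∀ {Q acc} → Decides Q acc →
        Decides (Q ⊎ ∃ λ v → toℕ v < k × P v)
                (iter (λ i acc → choose (⟦ u ⟧ n (acc ∷ num i ∷ ρ)) (nil ∙ nil) acc) k acc)
      any-loop zero    _   q = reflects-map inj₁ (λ { (inj₁ q) → q }) q
      any-loop (suc k) k<n {Q} {acc} q = reflects-map to from
        (any-loop k (ℕ.<⇒≤ k<n) (choose-∨ (decides< k<n acc) q))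
        where
        to : (P (fromℕ< k<n) ⊎ Q) ⊎ (∃ λ v → toℕ v < k × P v) → Q ⊎ ∃ λ v → toℕ v < suc k × P v
        to (inj₁ (inj₁ p))       = inj₂ (_ , s≤s (ℕ.≤-reflexive (Fin.toℕ-fromℕ< k<n)) , p)
        to (inj₁ (inj₂ q))       = inj₁ q
        to (inj₂ (v , v<k , p))  = inj₂ (v , ℕ.m<n⇒m<1+n v<k , p)
        from : Q ⊎ (∃ λ v → toℕ v < suc k × P v) → (P (fromℕ< k<n) ⊎ Q) ⊎ ∃ λ v → toℕ v < k × P v
        from (inj₁ q)            = inj₁ (inj₂ q)
        from (inj₂ (v , v< , p)) = last k<n (λ v → P v → (P (fromℕ< k<n) ⊎ Q) ⊎ ∃ λ v → toℕ v < k × P v)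
          (inj₁ ∘ inj₁) (λ v v<k p → inj₂ (v , v<k , p)) v v< p

      -- A hit overwrites the accumulator and later misses preserve it, so the accumulator either
      -- passes through unchanged or ends as the last hit.
      find-loop : ∀ k → k ≤ n → ∀ acc →
        let r = iter (λ i acc → choose (⟦ u ⟧ n (acc ∷ num i ∷ ρ)) (nil ∙ num i) acc) k acc in
        (r ≡ acc × ∀ v → toℕ v < k → ¬ P v) ⊎ ∃ λ v → r ≡ nil ∙ num (toℕ v) × P v
      find-loop zero    _   acc = inj₁ (refl , λ _ ())
      find-loop (suc k) k<n acc
        with ⟦ u ⟧ n (acc ∷ num k ∷ ρ) | decides< k<n acc
      ... | nil   | ofⁿ ¬p with find-loop k (ℕ.<⇒≤ k<n) acc
      ...   | inj₁ (eq , none) = inj₁ (eq , last k<n (λ v → ¬ P v) ¬p none)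
      ...   | inj₂ found       = inj₂ found
      find-loop (suc k) k<n acc | _ ∙ _ | ofʸ p with find-loop k (ℕ.<⇒≤ k<n) (nil ∙ num k)
      ...   | inj₁ (eq , _) = inj₂ (fromℕ< k<n , trans eq (cong (λ i → nil ∙ num i) (sym (Fin.toℕ-fromℕ< k<n))) , p)
      ...   | inj₂ found    = inj₂ found

      tabulated : ℕ → Tree → Tree
      tabulated = iter λ i acc → ⟦ u ⟧ n (acc ∷ num i ∷ ρ) ∙ acc

      -- The first component carries the induction: whatever is consed on at index `k` ends up at
      -- position `k` of the final list.
      tabulate-loop : ∀ k → k ≤ n → ∀ acc → dropT k (tabulated k acc) ≡ acc ×
        (∀ v → toℕ v < k → Decides (P v) (bit (tabulated k acc) (toℕ v)))
      tabulate-loop zero    _   acc = refl , λ _ ()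
      tabulate-loop (suc k) k<n acc = trans (dropT-tl k r) (cong tlᵗ eq) ,
        last k<n (λ v → Decides (P v) (bit r (toℕ v)))
          (subst (λ i → Decides (P (fromℕ< k<n)) (bit r i)) (sym (Fin.toℕ-fromℕ< k<n))
            (subst (Decides (P (fromℕ< k<n))) (cong hdᵗ (sym eq)) (decides< k<n acc)))
          (proj₂ ih)
        where
        r  = tabulated (suc k) acc
        ih = tabulate-loop k (ℕ.<⇒≤ k<n) (⟦ u ⟧ n (acc ∷ num k ∷ ρ) ∙ acc)
        eq = proj₁ ih

    any-decides : Decided n ρ (anyᵗ u) (∃ P)
    any-decides = decided (reflects-map (λ { (inj₁ ()) ; (inj₂ (v , _ , p)) → v , p }) (λ (v , p) → inj₂ (v , Fin.toℕ<n v , p))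
      (any-loop n ℕ.≤-refl {Q = ⊥} (ofⁿ id)))

    find-finds : (⟦ findᵗ u ⟧ n ρ ≡ nil × ∀ v → ¬ P v) ⊎ ∃ λ v → ⟦ findᵗ u ⟧ n ρ ≡ nil ∙ num (toℕ v) × P v
    find-finds with find-loop n ℕ.≤-refl nil
    ... | inj₁ (eq , none) = inj₁ (eq , λ v → none v (Fin.toℕ<n v))
    ... | inj₂ found       = inj₂ found

    tabulate-decides : ∀ v → Decides (P v) (bit (⟦ tabulateᵗ u ⟧ n ρ) (toℕ v))
    tabulate-decides v = proj₂ (tabulate-loop n ℕ.≤-refl nil) v (Fin.toℕ<n v)

-- Correctness of the greedy program on graphs.

module Correctness (G : Graph) where

  open Graph G renaming (order to n)
  open GraphTheory G
  open Greedy G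

  -- Every tree represents some set, so no well-formedness has to be maintained between rounds.
  remaining : Tree → Subset n
  remaining R = tabulate λ v → truth (bit R (toℕ v))

  remaining-decides : ∀ R v → Decides (v ∈ remaining R) (bit R (toℕ v))
  remaining-decides R v = reflects-map
    (λ eq → lookup⇒[]= v _ (trans (lookup∘tabulate _ v) eq))
    (λ v∈ → trans (sym (lookup∘tabulate _ v)) ([]=⇒lookup v∈))
    (≡true-reflects (truth (bit R (toℕ v))))
    where
    ≡true-reflects : ∀ b → Reflects (b ≡ true) b
    ≡true-reflects true  = ofʸ refl
    ≡true-reflects false = ofⁿ λ ()

  member-decides : ∀ {g} (ρ : Vec Tree g) {R x v} → lookup ρ x ≡ num (toℕ v) →
                   Decided n ρ (bitᵗ (var R) (var x)) (v ∈ remaining (lookup ρ R))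
  member-decides ρ {R} {x} {v} x-eq = decided
    (subst (Decides _) (sym (bit-value ρ (var R) (var x) x-eq)) (remaining-decides (lookup ρ R) v))

  module _ {g} (ρ : Vec Tree g) {A : Fin g} (A-eq : lookup ρ A ≡ encodeGraph G) where

    adj-decides : ∀ {x y u v} → lookup ρ x ≡ num (toℕ u) → lookup ρ y ≡ num (toℕ v) →
                  Decided n ρ (adjᵗ A x y) (Adj u v)
    adj-decides {x} {y} {u} {v} x-eq y-eq = decided (subst (Decides (Adj u v)) (sym value)
      (subst (Reflects (Adj u v)) (sym (truth-encodeBool (adj u v))) (T-reflects (adj u v))))
      where
      open ≡-Reasoning
      value : ⟦ adjᵗ A x y ⟧ n ρ ≡ encodeBool (adj u v)
      value = begin
        ⟦ adjᵗ A x y ⟧ n ρ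
          ≡⟨ bit-value ρ (bitᵗ (var A) (var x)) (var y) y-eq ⟩
        bit (⟦ bitᵗ (var A) (var x) ⟧ n ρ) (toℕ v)
          ≡⟨ cong (λ r → bit r (toℕ v))
               (trans (bit-value ρ (var A) (var x) x-eq) (cong (λ t → bit t (toℕ u)) A-eq)) ⟩
        bit (bit (encodeGraph G) (toℕ u)) (toℕ v)
          ≡⟨ cong (λ r → bit r (toℕ v)) (bit-encodeList (encodeList encodeBool) (L.tabulate ∘ adj) u) ⟩
        bit (encodeList encodeBool (L.tabulate (adj u))) (toℕ v)
          ≡⟨ bit-encodeList encodeBool (adj u) v ⟩
        encodeBool (adj u v) ∎

  module _ {g} (ρ : Vec Tree g) {A : Fin g} (A-eq : lookup ρ A ≡ encodeGraph G) where

    tie-decides : ∀ {x y u v} → lookup ρ x ≡ num (toℕ u) → lookup ρ y ≡ num (toℕ v) →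
                  Decided n ρ (tieᵗ A x y) (Tie u v)
    tie-decides x-eq y-eq = decided-∧ (adj-decides ρ A-eq x-eq y-eq)
      (decided-¬ (any-decides ρ λ acc w →
        let ρ′ = acc ∷ num (toℕ w) ∷ ρ in
        decided-∧ (adj-decides ρ′ A-eq x-eq refl) (adj-decides ρ′ A-eq y-eq refl)))

  module _ {g} (ρ : Vec Tree g) {A : Fin g} (A-eq : lookup ρ A ≡ encodeGraph G) (R : Fin g) where

    leaf-decides : ∀ {x v} → lookup ρ x ≡ num (toℕ v) →
                   Decided n ρ (leafᵗ A R x) (∃ (Leaf (remaining (lookup ρ R)) v))
    leaf-decides {v = v} x-eq = decided-map
      (λ (v∈ , w , w∈ , vw , unique) → w , v∈ , w∈ , vw ,
        λ {x} x∈ vx → decidable-stable (x Fin.≟ w) λ x≢w → unique (x , x∈ , vx , x≢w))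
      (λ (w , v∈ , w∈ , vw , unique) → v∈ , w , w∈ , vw , λ (x , x∈ , vx , x≢w) → x≢w (unique x∈ vx))
      (decided-∧ (member-decides ρ x-eq) (any-decides ρ λ acc w →
        let ρ′ = acc ∷ num (toℕ w) ∷ ρ in
        decided-∧ (member-decides ρ′ refl) (decided-∧ (tie-decides ρ′ A-eq x-eq refl)
          (decided-¬ (any-decides ρ′ λ acc′ x →
            let ρ″ = acc′ ∷ num (toℕ x) ∷ ρ′ in
            decided-∧ (member-decides ρ″ refl) (decided-∧ (tie-decides ρ″ A-eq x-eq refl)
              (decided-¬ (eq-decides ρ″ (var i₁) (var (up i₁)) refl refl))))))))

  Stuck : Subset n → Set
  Stuck R = ∀ v w → ¬ Leaf R v w

  module _ {g} (ρ : Vec Tree g) {A : Fin g} (A-eq : lookup ρ A ≡ encodeGraph G) (R : Fin g) where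

    private
      R₀ = lookup ρ R

      keptᵗ : Tm (4 + g)
      keptᵗ = bitᵗ (var (up (up R))) (var i₁) andᵗ notᵗ (eqᵗ (var i₁) (var (up zero))) andᵗ
              notᵗ (tieᵗ (up (up A)) (up zero) i₁)

      Kept : Vertex → Vertex → Set
      Kept v x = x ∈ remaining R₀ × x ≢ v × ¬ Tie v x

      kept-decides : ∀ r v acc x →
        Decided n (acc ∷ num (toℕ x) ∷ num (toℕ v) ∷ r ∷ ρ) keptᵗ (Kept v x)
      kept-decides r v acc x =
        let ρ′ = acc ∷ num (toℕ x) ∷ num (toℕ v) ∷ r ∷ ρ in
        decided-∧ (member-decides ρ′ refl)
          (decided-∧ (decided-¬ (eq-decides ρ′ (var i₁) (var (up zero)) refl refl))
            (decided-¬ (tie-decides ρ′ A-eq refl refl)))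

      pruned : Tree → Tree
      pruned r = choose r (⟦ tabulateᵗ keptᵗ ⟧ n (tlᵗ r ∷ r ∷ ρ)) R₀

      HasLeaf : Vertex → Set
      HasLeaf v = ∃ (Leaf (remaining R₀) v)

      pruned-correct : ∀ {r} → (r ≡ nil × ∀ v → ¬ HasLeaf v) ⊎ (∃ λ v → r ≡ nil ∙ num (toℕ v) × HasLeaf v) →
        (pruned r ≡ R₀ × Stuck (remaining R₀)) ⊎ Prune (remaining R₀) (remaining (pruned r))
      pruned-correct (inj₁ (refl , none)) = inj₁ (refl , λ v w leaf → none v (w , leaf))
      pruned-correct (inj₂ (v , refl , w , leaf@(_ , _ , vw , unique))) = inj₂ record
        { leaf  = leaf
        ; kept  = λ x∈ → let (x∈R , x≢v , ¬vx) = to x∈ in x∈R , x≢v , λ { refl → ¬vx vw }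
        ; keeps = λ x∈R x≢v x≢w → from (x∈R , x≢v , λ vx → x≢w (unique x∈R vx))
        }
        where
        r = nil ∙ num (toℕ v)
        bits : ∀ x → Decides (Kept v x) (bit (pruned r) (toℕ x))
        bits = tabulate-decides (num (toℕ v) ∷ r ∷ ρ) (kept-decides r v)
        to : ∀ {x} → x ∈ remaining (pruned r) → Kept v x
        to {x} = reflects-⇒ (remaining-decides (pruned r) x) (bits x)
        from : ∀ {x} → Kept v x → x ∈ remaining (pruned r)
        from {x} = reflects-⇒ (bits x) (remaining-decides (pruned r) x)

    prune-correct : (⟦ pruneᵗ A R ⟧ n ρ ≡ R₀ × Stuck (remaining R₀)) ⊎
                    Prune (remaining R₀) (remaining (⟦ pruneᵗ A R ⟧ n ρ))
    prune-correct = pruned-correct (find-finds ρ λ acc v → leaf-decides (acc ∷ num (toℕ v) ∷ ρ) {up A} A-eq (up R) {i₁} refl)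

  prune-shrinks : ∀ {R R′} → Prune R R′ → ∣ R′ ∣ < ∣ R ∣
  prune-shrinks prune = p⊂q⇒∣p∣<∣q∣ (proj₁ ∘ kept , v , proj₁ leaf , λ v∈ → proj₁ (proj₂ (kept v∈)) refl)
    where open Prune prune

  module _ (f : ℕ → Tree → Tree)
    (step : ∀ i R → (f i R ≡ R × Stuck (remaining R)) ⊎ Prune (remaining R) (remaining (f i R))) where

    -- A round that prunes shrinks the set, so `k` rounds suffice for a set of at most `k` vertices.
    -- A round that finds no leaf changes nothing, and neither do those after it.
    iter-stuck : ∀ k R → ∣ remaining R ∣ ≤ k → Stuck (remaining (iter f k R))
    iter-stuck zero R ≤0 v w (v∈ , _) = contradiction (ℕ.≤-trans (x∈p⇒∣p-x∣<∣p∣ v∈) ≤0) λ ()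
    iter-stuck (suc k) R ≤k with step k R
    ... | inj₁ (eq , stuck) = subst (Stuck ∘ remaining) (sym (trans (cong (iter f k) eq) (fixed k))) stuck
      where
      fixed : ∀ k → iter f k R ≡ R
      fixed zero    = refl
      fixed (suc k) with step k R
      ... | inj₁ (eq , _) = trans (cong (iter f k) eq) (fixed k)
      ... | inj₂ prune    = contradiction (Prune.leaf prune) (stuck _ _)
    ... | inj₂ prune = iter-stuck k (f k R) (ℕ.≤-pred (ℕ.≤-trans (prune-shrinks prune) ≤k))

    -- Applied to a balanced colouring it justifies acceptance, and applied to `MateClosed` it
    -- justifies rejection.
    iter-invariant : (I : Subset n → Set) → (∀ {R R′} → Prune R R′ → I R → I R′) →
                     ∀ k R → I (remaining R) → I (remaining (iter f k R))
    iter-invariant I preserves zero    R i = i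
    iter-invariant I preserves (suc k) R i with step k R
    ... | inj₁ (eq , _) = iter-invariant I preserves k (f k R) (subst (I ∘ remaining) (sym eq) i)
    ... | inj₂ prune    = iter-invariant I preserves k (f k R) (preserves prune i)

  private
    input : Vec Tree 1
    input = encodeGraph G ∷ []

    R₀ = ⟦ tabulateᵗ trueᵗ ⟧ n input
    round : ℕ → Tree → Tree
    round i R = ⟦ pruneᵗ (up zero) i₀ ⟧ n (R ∷ num i ∷ input)
    final = ⟦ greedyᵗ ⟧ n input

    round-correct : ∀ i R → (round i R ≡ R × Stuck (remaining R)) ⊎ Prune (remaining R) (remaining (round i R))
    round-correct i R = prune-correct (R ∷ num i ∷ input) {up zero} refl i₀

    all-remain : ∀ v → v ∈ remaining R₀
    all-remain v = reflects-⇒ (tabulate-decides input {P = λ _ → ⊤} {trueᵗ} (λ _ _ → decided (ofʸ tt)) v)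
      (remaining-decides R₀ v) tt

    final-stuck : Stuck (remaining final)
    final-stuck = iter-stuck round round-correct n R₀ (∣p∣≤n (remaining R₀))

  matching-decides : Decided n input matchingᵗ (Vertex × ¬ ∃ λ v → v ∈ remaining final)
  matching-decides = decided-∧
    (decided (nonempty-encodeList (encodeList encodeBool) (L.tabulate ∘ adj)))
    (decided (choose-¬ (decides (any-decides (final ∷ input) λ acc v →
      member-decides (acc ∷ num (toℕ v) ∷ final ∷ input) {up zero} {i₁} refl))))

  module _ (pseudoChordal : PseudoChordal G) where

    private
      bridge : ∀ {v w} → Tie v w → Bridge v w
      bridge = tie⇒bridge pseudoChordal

    matched⇒cut : Vertex × ¬ (∃ λ v → v ∈ remaining final) → HasPerfectMatchingCut G
    matched⇒cut (x₀ , empty) with iter-invariant round round-correct (λ R → ∃ (Balanced R))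
      (λ prune (c , balanced) → flipped bridge prune balanced , flipped-balanced bridge prune balanced) n R₀
      -- Initially all vertices remain, and a constant colouring has no bichromatic edge.
      ((λ _ → false) , λ x → (λ { _ _ (_ , ≢) → ≢ refl }) , λ x∉ → contradiction (all-remain x) x∉)
    ... | c , balanced = balanced⇒cut balanced (λ x x∈ → empty (x , x∈)) x₀

    cut⇒matched : HasPerfectMatchingCut G → Vertex × ¬ ∃ λ v → v ∈ remaining final
    cut⇒matched (C , pm) = proj₁ (Cut.X≢∅ C) , λ (v , v∈) →
      stuck⇒empty C pm bridge closed final-stuck v v∈
      where
      closed : MateClosed C pm (remaining final)
      closed = iter-invariant round round-correct (MateClosed C pm) (prune-closed C pm) n R₀ λ {_} {y} _ _ → all-remain y

    -- `Decides` fixes only whether a tree is `nil`, whereas the output has to be literally an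
    -- encoded Boolean.
    canonical : ∀ s t → let r = choose s (choose t nil (nil ∙ nil)) nil in r ≡ encodeBool (truth r)
    canonical nil     t       = refl
    canonical (_ ∙ _) nil     = refl
    canonical (_ ∙ _) (_ ∙ _) = refl

    matching-correct : Σ (Dec (HasPerfectMatchingCut G)) λ P? →
                       ⟦ matchingᵗ ⟧ (spine (encodeGraph G)) input ≡ encodeBool (does P?)
    matching-correct =
      (truth (⟦ matchingᵗ ⟧ n input) because reflects-map matched⇒cut cut⇒matched (decides matching-decides)) ,
      trans (cong (λ k → ⟦ matchingᵗ ⟧ k input) (spine-encodeList (encodeList encodeBool) (L.tabulate ∘ adj)))
            (canonical (encodeGraph G) _)

theorem6 : PolyTimeDecidable encodeGraph PseudoChordal HasPerfectMatchingCut
theorem6 = computes⇒polyTimeDecidable matchingᵗ Correctness.matching-correct
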